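{- The Koebe degree of any stacked $3$-polytope equals one.
   Context: A $3$-polytope is a $3$-dimensional convex polytope. A stacked $3$-polytope is a simplicial $3$-polytope obtained by starting with a $3$-simplex (tetrahedron) and successively adding vertices, each beyond a facet of the current polytope (stacking over that facet). Two polytopes are combinatorially equivalent if their face lattices are isomorphic; a realization of $P$ is a polytope in $\mathbb{R}^3$ combinatorially equivalent to $P$. A Koebe realization of a $3$-polytope $P$ is a realization $Q\subset\mathbb{R}^3$ of $P$ such that every edge (line segment) of $Q$ is tangent to the unit sphere $\mathbb{S}^2\subset\mathbb{R}^3$. For a realization $R$, $\mathbb{Q}[R]$ denotes the extension field of $\mathbb{Q}$ generated by all vertex coordinates of $R$. The Koebe degree $\kappa(P)$ is the minimum of the field extension degrees $|\mathbb{Q}[Q]:\mathbb{Q}|$, where $Q$ ranges over all Koebe realizations of $P$; thus $\kappa(P)=1$ means that $P$ has a Koebe realization with rational vertex coordinates. -}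

module Defs where

open import Level using (Level; suc; _⊔_)
open import Algebra.Bundles using (CommutativeRing)
import Algebra.Definitions.RawMonoid as RawMonoid
import Algebra.Properties.Monoid.Sum as MonoidSum
open import Data.Integer.Base using (ℤ; +_; -[1+_])
open import Data.Nat.Base as ℕ using (ℕ)
open import Data.Product.Base using (_×_; ∃; ∃₂; ∃-syntax)
open import Data.Rational.Unnormalised.Base using (ℚᵘ; ↥_; ↧_)
open import Data.Sum.Base using (_⊎_)
open import Data.Vec.Functional using (Vector; _∷_)
open import Data.Vec.Functional.Relation.Binary.Pointwise using (Pointwise)
open import Relation.Binary.Core using (Rel)
open import Relation.Binary.Morphism.Structures using (IsOrderIsomorphism)
open import Relation.Binary.Structures using (IsStrictTotalOrder)
open import Relation.Nullary.Negation.Core using (¬_)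
open import Relation.Unary using (Pred; _∈_; _≐_; Satisfiable)

-- The axioms of the (classical) real numbers: a Dedekind-complete totally
-- ordered field.

record RealNumbers (c ℓ : Level) : Set (suc (c ⊔ ℓ)) where
  infix 4 _<_ _≤_
  field
    commutativeRing : CommutativeRing c ℓ
  open CommutativeRing commutativeRing public
  field
    _<_                : Rel Carrier ℓ
    isStrictTotalOrder : IsStrictTotalOrder _≈_ _<_

  _≤_ : Rel Carrier ℓ
  x ≤ y = x < y ⊎ x ≈ y

  UpperBound : Pred Carrier (c ⊔ ℓ) → Pred Carrier (c ⊔ ℓ)
  UpperBound S u = ∀ x → x ∈ S → x ≤ u

  field
    0<1        : 0# < 1#
    +-monoˡ-<  : ∀ z {x y} → x < y → x + z < y + z
    *-pos      : ∀ {x y} → 0# < x → 0# < y → 0# < x * y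
    inverse    : ∀ x → ¬ (x ≈ 0#) → ∃[ y ] x * y ≈ 1#
    supremum   : ∀ (S : Pred Carrier (c ⊔ ℓ)) →
                 Satisfiable S → Satisfiable (UpperBound S) →
                 ∃[ s ] (s ∈ UpperBound S × (∀ u → u ∈ UpperBound S → s ≤ u))

module Koebe {c ℓ : Level} (ℝ : RealNumbers c ℓ) where

  open RealNumbers ℝ
  open MonoidSum +-monoid using (sum)
  open RawMonoid +-rawMonoid using () renaming (_×_ to _·ℕ_)

  fromℤ : ℤ → Carrier
  fromℤ (+ n)    = n ·ℕ 1#
  fromℤ -[1+ n ] = - (ℕ.suc n ·ℕ 1#)

  Rational : Pred Carrier ℓ
  Rational x = ∃ λ (q : ℚᵘ) → fromℤ (↧ q) * x ≈ fromℤ (↥ q)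

  data ℚ[_] (G : Pred Carrier (c ⊔ ℓ)) : Pred Carrier (c ⊔ ℓ) where
    rational  : ∀ {x} → x ∈ Rational → x ∈ ℚ[ G ]
    generator : ∀ {x} → x ∈ G → x ∈ ℚ[ G ]
    plus      : ∀ {x y} → x ∈ ℚ[ G ] → y ∈ ℚ[ G ] → x + y ∈ ℚ[ G ]
    negate    : ∀ {x} → x ∈ ℚ[ G ] → - x ∈ ℚ[ G ]
    times     : ∀ {x y} → x ∈ ℚ[ G ] → y ∈ ℚ[ G ] → x * y ∈ ℚ[ G ]
    invert    : ∀ {x y} → x ∈ ℚ[ G ] → x * y ≈ 1# → y ∈ ℚ[ G ]
    resp      : ∀ {x y} → x ∈ ℚ[ G ] → x ≈ y → y ∈ ℚ[ G ]

  record IsBasisOverℚ (L : Pred Carrier (c ⊔ ℓ)) {d : ℕ} (b : Vector Carrier d)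
         : Set (c ⊔ ℓ) where
    field
      member      : ∀ i → b i ∈ L
      spanning    : ∀ x → x ∈ L →
                    ∃ λ (q : Vector Carrier d) →
                    (∀ i → q i ∈ Rational) × x ≈ sum (λ i → q i * b i)
      independent : ∀ (q : Vector Carrier d) → (∀ i → q i ∈ Rational) →
                    sum (λ i → q i * b i) ≈ 0# → ∀ i → q i ≈ 0#

  HasDegreeOverℚ : Pred Carrier (c ⊔ ℓ) → ℕ → Set (c ⊔ ℓ)
  HasDegreeOverℚ L d = ∃ λ (b : Vector Carrier d) → IsBasisOverℚ L b

  Point : Set c
  Point = Vector Carrier 3

  infix 4 _≋_
  _≋_ : Rel Point ℓ
  x ≋ y = Pointwise _≈_ x y

  infixl 7 _∙_
  _∙_ : Point → Point → Carrier
  x ∙ y = sum (λ k → x k * y k)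

  linearCombination : ∀ {n} → Vector Carrier n → Vector Point n → Point
  linearCombination t p k = sum (λ i → t i * p i k)

  AffineHull : ∀ {n} → Vector Point n → Pred Point (c ⊔ ℓ)
  AffineHull p x = ∃[ t ] (sum t ≈ 1# × x ≋ linearCombination t p)

  ConvexHull : ∀ {n} → Vector Point n → Pred Point (c ⊔ ℓ)
  ConvexHull p x =
    ∃[ t ] ((∀ i → 0# ≤ t i) × sum t ≈ 1# × x ≋ linearCombination t p)

  AffinelyIndependent : ∀ {n} → Vector Point n → Set (c ⊔ ℓ)
  AffinelyIndependent p =
    ∀ t → sum t ≈ 0# → (∀ k → linearCombination t p k ≈ 0#) → ∀ i → t i ≈ 0#

  HasDimension : ∀ {s} → ℕ → Pred Point s → Set (c ⊔ ℓ ⊔ s)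
  HasDimension d S = ∃ λ (p : Vector Point (ℕ.suc d)) →
    (∀ i → p i ∈ S) × AffinelyIndependent p × (∀ x → x ∈ S → x ∈ AffineHull p)

  -- A polytope is given by a finite family of points of which it is the convex
  -- hull; the family may be redundant, so its members need not be vertices.

  record Polytope : Set c where
    constructor conv
    field
      {size}     : ℕ
      generators : Vector Point size

  open Polytope public

  ⟦_⟧ : Polytope → Pred Point (c ⊔ ℓ)
  ⟦ P ⟧ = ConvexHull (generators P)

  -- A face is P ∩ {x ∣ a ∙ x = b} for an inequality a ∙ x ≤ b valid on P.
  -- With a = 0 this includes the empty face and P itself.  Different
  -- inequalities may define the same face, hence the equality _≈ᶠ_.

  record Face (P : Polytope) : Set (c ⊔ ℓ) where
    field
      normal : Point
      offset : Carrier
      valid  : ∀ x → x ∈ ⟦ P ⟧ → normal ∙ x ≤ offset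

  open Face public

  module _ {P : Polytope} where

    points : Face P → Pred Point (c ⊔ ℓ)
    points F x = x ∈ ⟦ P ⟧ × normal F ∙ x ≈ offset F

    infix 4 _≤ᶠ_ _≈ᶠ_

    _≤ᶠ_ : Rel (Face P) (c ⊔ ℓ)
    F ≤ᶠ G = ∀ x → x ∈ points F → x ∈ points G

    _≈ᶠ_ : Rel (Face P) (c ⊔ ℓ)
    F ≈ᶠ G = F ≤ᶠ G × G ≤ᶠ F

    IsFacet IsEdge : Pred (Face P) (c ⊔ ℓ)
    IsFacet F = HasDimension 2 (points F)
    IsEdge  F = HasDimension 1 (points F)

  IsVertex : Polytope → Pred Point (c ⊔ ℓ)
  IsVertex P x = ∃ λ (F : Face P) → points F ≐ (_≋ x)

  CombinatoriallyEquivalent : Rel Polytope (c ⊔ ℓ)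
  CombinatoriallyEquivalent P Q =
    ∃ λ (f : Face P → Face Q) → IsOrderIsomorphism _≈ᶠ_ _≈ᶠ_ _≤ᶠ_ _≤ᶠ_ f

  -- Stacking over F means beyond F and beneath all other facets; being beyond
  -- F alone would allow other facets to be destroyed.

  record Beyond {P : Polytope} (F : Face P) (x : Point) : Set (c ⊔ ℓ) where
    field
      beyond  : offset F < normal F ∙ x
      beneath : ∀ (G : Face P) → IsFacet G → ¬ (G ≈ᶠ F) → normal G ∙ x < offset G

  data StackedVertices : ∀ {n} → Vector Point n → Set (c ⊔ ℓ) where
    simplex : ∀ (v : Vector Point 4) → AffinelyIndependent v → StackedVertices v
    stack   : ∀ {n} {v : Vector Point n} → StackedVertices v →
              (F : Face (conv v)) → IsFacet F →
              (x : Point) → Beyond F x → StackedVertices (x ∷ v)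

  IsStacked : Pred Polytope (c ⊔ ℓ)
  IsStacked P =
    ∃₂ λ n (v : Vector Point n) → StackedVertices v × ⟦ P ⟧ ≐ ConvexHull v

  UnitSphere : Pred Point ℓ
  UnitSphere p = p ∙ p ≈ 1#

  -- {x ∣ p ∙ x = 1} is the tangent plane of the sphere at p.

  TangentToUnitSphere : Pred Point (c ⊔ ℓ) → Set (c ⊔ ℓ)
  TangentToUnitSphere S =
    ∃[ p ] (p ∈ S × p ∈ UnitSphere × (∀ x → x ∈ S → p ∙ x ≈ 1#))

  record KoebeRealization (P : Polytope) : Set (c ⊔ ℓ) where
    field
      polytope   : Polytope
      equivalent : CombinatoriallyEquivalent P polytope
      tangent    : ∀ (E : Face polytope) → IsEdge E → TangentToUnitSphere (points E)

  VertexCoordinate : Polytope → Pred Carrier (c ⊔ ℓ)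
  VertexCoordinate P y = ∃₂ λ x k → IsVertex P x × y ≈ x k

  HasDegree : ∀ {P} → KoebeRealization P → ℕ → Set (c ⊔ ℓ)
  HasDegree Q d =
    HasDegreeOverℚ ℚ[ VertexCoordinate (KoebeRealization.polytope Q) ] d

  -- Realizations of infinite degree do not affect the minimum.

  KoebeDegreeEquals : Polytope → ℕ → Set (c ⊔ ℓ)
  KoebeDegreeEquals P d =
    (∃ λ (Q : KoebeRealization P) → HasDegree Q d) ×
    (∀ (Q : KoebeRealization P) d′ → HasDegree Q d′ → d ℕ.≤ d′)

{-# OPTIONS --safe #-}

-- A Koebe realization is the same as a family of vectors of norm 2 for the
-- Lorentz form B, one per vertex, with B = -2 along the edges.  Three such
-- vectors a, b, c spanning a facet with Lorentz normal N, also of norm 2, are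
-- completed by a + b + c + 2 N (Descartes' circle theorem), and the three new
-- facets have the normals N + a + b, N + b + c and N + c + a.  So stacking keeps
-- all homogeneous coordinates integral, starting from the regular tetrahedron
-- (±1, ±1, ±1).
-- That the new vertex is beyond exactly one facet follows from B ≤ -2 for
-- distinct vertices and for distinct normals, which stacking preserves.
--
-- On the other side, faces of a stacked polytope correspond to the vertex sets
-- that are intersections of facets, because every valid inequality is a
-- nonnegative combination of facet inequalities; hence the face lattice depends
-- only on the list of facet triangles.

module Submission where

open import Defs
open import Level using (_⊔_)
open import Algebra.Bundles using (RawRing)
import Algebra.Properties.AbelianGroup as AbelianGroupProperties
import Algebra.Properties.Ring as RingProperties
import Algebra.Properties.Semiring.Mult.TCOptimised as Mult
import Algebra.Properties.Semiring.Sum as SemiringSum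
import Algebra.Solver.Ring as RingSolver
open import Algebra.Solver.Ring.AlmostCommutativeRing
  using (fromCommutativeRing; _-Raw-AlmostCommutative⟶_)
open import Data.Fin.Base using (Fin; zero; suc; punchIn; punchOut; splitAt; join; _↑ˡ_; _↑ʳ_)
import Data.Fin.Properties as Finₚ
open import Data.Integer.Base as ℤ using (ℤ; +_; -[1+_]; _⊖_; _◃_)
import Data.Integer.Properties as ℤₚ
open import Data.Maybe.Base using (Maybe; just; nothing)
open import Data.Nat.Base as ℕ using (ℕ; zero; suc)
open import Data.Product.Base using (_×_; _,_; ∃; ∃₂; proj₁; proj₂)
open import Data.Rational.Unnormalised.Base using (mkℚᵘ)
import Data.Sign.Base as Sign
open import Data.Sum.Base using (_⊎_; inj₁; inj₂)
open import Data.Vec.Functional as Vector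
  using (Vector; insertAt; removeAt; updateAt; _++_; _∷_; tail)
open import Data.Vec.Functional.Properties
  using (insertAt-lookup; insertAt-punchIn; updateAt-updates; updateAt-minimal; lookup-++ˡ)
import Data.Vec.Functional.Relation.Binary.Pointwise.Properties as Pointwiseₚ
import Data.Vec.Functional.Relation.Unary.All.Properties as Allₚ
open import Function.Base using (_∘_; const; case_of_; id)
import Relation.Binary.Construct.StrictToNonStrict as NonStrict
open import Relation.Binary.Definitions using (tri<; tri≈; tri>)
open import Relation.Binary.PropositionalEquality as ≡ using (_≡_; _≢_)
import Relation.Binary.Reasoning.Setoid as SetoidReasoning
open import Relation.Binary.Structures using (IsStrictTotalOrder)
open import Relation.Nullary using (¬_; ¬?; Dec; yes; no; contradiction; _→-dec_)
open import Relation.Nullary.Decidable using (decidable-stable; from-yes)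
open import Relation.Unary using (_≐_; _∈_)

-- Combinatorics of triangulated spheres

-- Descartes' formula contains a square root. It disappears because the facet normals are carried
-- along as data: if `a`, `b`, `c` have norm 2 and pairwise products -2, then `w = a + b + c` has
-- norm -6, so for `N` of norm 2 orthogonal to `w` the vector `w + λ N` has norm 2 exactly for λ = 2
-- and λ = -2. The sign taken is the one that puts the new vertex beyond the facet. The given
-- polytope and its Koebe model are both described by `IsConfiguration` over one and the same list
-- of triangles and grow in parallel, so no face map has to be followed through the stacking steps.
-- The obstacle is that a face is an arbitrary valid inequality on a convex hull. In place of a
-- general Farkas lemma, the field `cone` of `IsConfiguration` serves as an invariant, checked for a
-- simplex and preserved by one stacking step. The same field recovers, from the face named in
-- `Beyond`, the triangle over which the polytope is stacked.

punchIn-elim : ∀ {n p} (P : Fin (suc n) → Set p) j → P j → (∀ i → P (punchIn j i)) → ∀ i → P i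
punchIn-elim P j Pj Pi i with j Finₚ.≟ i
... | yes j≡i = ≡.subst P j≡i Pj
... | no  j≢i = ≡.subst P (Finₚ.punchIn-punchOut j≢i) (Pi (punchOut j≢i))

module _ {a m n} {A : Set a} (xs : Vector A m) (ys : Vector A n) where

  ++-existsˡ : ∀ {p} (P : A → Set p) i → P (xs i) → ∃ λ j → P ((xs ++ ys) j)
  ++-existsˡ P i Px = i ↑ˡ n , ≡.subst P (≡.sym (lookup-++ˡ xs ys i)) Px

  private
    splitAt-injective : ∀ i j → splitAt m i ≡ splitAt m {n} j → i ≡ j
    splitAt-injective i j eq =
      ≡.trans (≡.sym (Finₚ.join-splitAt m n i)) (≡.trans (≡.cong (join m n) eq) (Finₚ.join-splitAt m n j))

  ++-pairwise : ∀ {r} (R : A → A → Set r) →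
    (∀ i j → i ≢ j → R (xs i) (xs j)) → (∀ i j → R (xs i) (ys j)) → (∀ i j → R (ys i) (xs j)) →
    (∀ i j → i ≢ j → R (ys i) (ys j)) → ∀ i j → i ≢ j → R ((xs ++ ys) i) ((xs ++ ys) j)
  ++-pairwise R xx xy yx yy i j i≢j
    with splitAt m i in eqᵢ | splitAt m j in eqⱼ
  ... | inj₁ i′ | inj₁ j′ = xx i′ j′ λ i≡j → i≢j (splitAt-injective i j (≡.trans eqᵢ (≡.trans (≡.cong inj₁ i≡j) (≡.sym eqⱼ))))
  ... | inj₁ i′ | inj₂ j′ = xy i′ j′
  ... | inj₂ i′ | inj₁ j′ = yx i′ j′
  ... | inj₂ i′ | inj₂ j′ = yy i′ j′ λ i≡j → i≢j (splitAt-injective i j (≡.trans eqᵢ (≡.trans (≡.cong inj₂ i≡j) (≡.sym eqⱼ))))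

Triangle : ℕ → Set
Triangle n = Fin 3 → Fin n

infix 4 _∈△_ _∉△_ _∈△?_

_∈△_ _∉△_ : ∀ {n} → Fin n → Triangle n → Set
i ∈△ t = ∃ λ s → t s ≡ i
i ∉△ t = ¬ i ∈△ t

_∈△?_ : ∀ {n} (i : Fin n) (t : Triangle n) → Dec (i ∈△ t)
i ∈△? t = Finₚ.any? (λ s → t s Finₚ.≟ i)

off-edge : ∀ {n} (t : Triangle n) s i → (∀ r → r ≢ s → t r ≢ i) → i ∉△ t ⊎ t s ≡ i
off-edge t s i i∉ with i ∈△? t
... | no i∉t = inj₁ i∉t
... | yes (r , tr≡i) with r Finₚ.≟ s
... | yes ≡.refl = inj₂ tr≡i
... | no  r≢s    = contradiction tr≡i (i∉ r r≢s)

-- A witness rather than a negated equality: the corner itself is used when neighbours are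
-- reassigned and when facets are told apart.
Distinct : ∀ {n} → Triangle n → Triangle n → Set
Distinct t t′ = ∃ λ s → t s ∉△ t′

-- t′ meets t in the edge opposite to its s-th vertex.
Adjacent : ∀ {n} → Triangle n → Fin 3 → Triangle n → Set
Adjacent t s t′ = t s ∉△ t′ × (∀ r → r ≢ s → t r ∈△ t′)

-- The two combinatorial facts on which the geometry draws: no facet lies in another, and every edge
-- of a facet lies on a second one. Convexity enters separately, through `IsConfiguration`.
record IsTriangulation {n m} (t : Fin m → Triangle n) : Set where
  field
    distinct  : ∀ j k → j ≢ k → Distinct (t j) (t k)
    neighbour : ∀ j s → ∃ λ k → Adjacent (t j) s (t k)

  neighbour-≢ : ∀ j s → j ≢ proj₁ (neighbour j s)
  neighbour-≢ j s j≡k =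
    let k , tjs∉tk , _ = neighbour j s
    in tjs∉tk (s , ≡.cong (λ l → t l s) (≡.sym j≡k))

  -- The neighbour across the edge opposite the corner `s` contains the corner `r` but not the
  -- corner `s`. This is how the corners of a `Triangle`, a mere map, come to be distinct.
  injective : ∀ j {r s} → r ≢ s → t j r ≢ t j s
  injective j {r} {s} r≢s tjr≡tjs =
    let k , tjs∉tk , rest = neighbour j s
    in tjs∉tk (≡.subst (_∈△ t k) tjr≡tjs (rest r r≢s))

-- Overwriting the corner in place keeps the positions of the other two, so that edges of `t` and of
-- the new triangle are indexed alike.
cone△ : ∀ {n} → Triangle n → Fin 3 → Triangle (suc n)
cone△ t s = updateAt (suc ∘ t) s (const zero)

module _ {n} (t : Triangle n) (s : Fin 3) where

  cone△-apex : cone△ t s s ≡ zero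
  cone△-apex = updateAt-updates s (suc ∘ t)

  cone△-base : ∀ {r} → r ≢ s → cone△ t s r ≡ suc (t r)
  cone△-base {r} r≢s = updateAt-minimal r s (suc ∘ t) r≢s

  cone△-elim : ∀ {p} (P : Fin (suc n) → Set p) → P zero → (∀ r → r ≢ s → P (suc (t r))) →
               ∀ r → P (cone△ t s r)
  cone△-elim P P0 Pt r with r Finₚ.≟ s
  ... | yes ≡.refl = ≡.subst P (≡.sym cone△-apex) P0
  ... | no  r≢s    = ≡.subst P (≡.sym (cone△-base r≢s)) (Pt r r≢s)

  apex∈cone△ : zero ∈△ cone△ t s
  apex∈cone△ = s , cone△-apex

  base∈cone△ : ∀ {r} → r ≢ s → suc (t r) ∈△ cone△ t s
  base∈cone△ {r} r≢s = r , cone△-base r≢s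

  base∉cone△ : ∀ {i} → (∀ r → r ≢ s → t r ≢ i) → suc i ∉△ cone△ t s
  base∉cone△ {i} ∉base (r , eq) =
    cone△-elim (_≢ suc i) (λ ()) (λ r r≢s eq → ∉base r r≢s (Finₚ.suc-injective eq)) r eq

lift∉ : ∀ {n} (t : Triangle n) {i} → i ∉△ t → suc i ∉△ suc ∘ t
lift∉ t i∉t (s , eq) = i∉t (s , Finₚ.suc-injective eq)

lift∈ : ∀ {n} (t : Triangle n) {i} → i ∈△ t → suc i ∈△ suc ∘ t
lift∈ t (s , eq) = s , ≡.cong suc eq

module Stack {n m} (t : Fin (suc m) → Triangle n) (j : Fin (suc m)) where

  new : Fin 3 → Triangle (suc n)
  new = cone△ (t j)

  old : Fin m → Triangle (suc n)
  old k = suc ∘ t (punchIn j k)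

-- The new vertex is `zero` and all old ones are shifted by `suc`. The length `3 + m` is again a
-- successor, so stacking can be iterated.
stack△ : ∀ {n m} (t : Fin (suc m) → Triangle n) → Fin (suc m) → Fin (3 ℕ.+ m) → Triangle (suc n)
stack△ t j = Stack.new t j ++ Stack.old t j

stack△-isTriangulation : ∀ {n m} {t : Fin (suc m) → Triangle n} → IsTriangulation t →
                         ∀ j → IsTriangulation (stack△ t j)
stack△-isTriangulation {n} {m} {t} T j = record
  { distinct  = ++-pairwise new old Distinct
      (λ s s′ s≢s′ → s′ , ≡.subst (_∉△ new s′) (≡.sym (cone△-base (t j) s (s≢s′ ∘ ≡.sym)))
                       (base∉cone△ (t j) s′ (λ r r≢s′ → injective j r≢s′)))
      -- The apex lies in no old triangle. Conversely, an old triangle has a corner outside `t j`,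
      -- whereas the corners of a new triangle other than the apex are corners of `t j`.
      (λ s k → s , ≡.subst (_∉△ old k) (≡.sym (cone△-apex (t j) s)) λ { (_ , ()) })
      (λ k s → let r , tkr∉tj = distinct (punchIn j k) j (Finₚ.punchInᵢ≢i j k)
               in r , base∉cone△ (t j) s λ q _ eq → tkr∉tj (q , eq))
      (λ k k′ k≢k′ → let r , tkr∉ = distinct _ _ (k≢k′ ∘ Finₚ.punchIn-injective j k k′)
                     in r , lift∉ (t (punchIn j k′)) tkr∉)
  ; neighbour = λ i → Allₚ.++⁺ (λ t′ → ∀ s → ∃ λ k → Adjacent t′ s (stack△ t j k)) new-neighbour old-neighbour i
  }
  where
  open IsTriangulation T
  open Stack t j

  in-old : ∀ t′ s k → k ≢ j → Adjacent t′ s (suc ∘ t k) → ∃ λ k → Adjacent t′ s (stack△ t j k)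
  in-old t′ s k k≢j adj = 3 ↑ʳ punchOut (k≢j ∘ ≡.sym) ,
    ≡.subst (λ l → Adjacent t′ s (suc ∘ t l)) (≡.sym (Finₚ.punchIn-punchOut (k≢j ∘ ≡.sym))) adj

  in-new : ∀ t′ s r → Adjacent t′ s (new r) → ∃ λ k → Adjacent t′ s (stack△ t j k)
  in-new t′ s r = ++-existsˡ new old (Adjacent t′ s) r

  new-neighbour : ∀ s r → ∃ λ k → Adjacent (new s) r (stack△ t j k)
  new-neighbour s r with r Finₚ.≟ s
  -- The edge opposite the apex is an edge of the removed triangle, whose old neighbour takes over.
  ... | yes ≡.refl =
    let k , tjs∉tk , rest = neighbour j s
    in in-old (new s) s k (neighbour-≢ j s ∘ ≡.sym)
         ( ≡.subst (_∉△ suc ∘ t k) (≡.sym (cone△-apex (t j) s)) (λ { (_ , ()) })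
         , λ q q≢s → ≡.subst (_∈△ suc ∘ t k) (≡.sym (cone△-base (t j) s q≢s)) (lift∈ (t k) (rest q q≢s)))
  -- An edge through the apex is shared by two new triangles.
  ... | no r≢s = in-new (new s) r r
         ( ≡.subst (_∉△ new r) (≡.sym (cone△-base (t j) s r≢s)) (base∉cone△ (t j) r (λ q q≢r → injective j q≢r))
         , λ q q≢r → cone△-elim′ q q≢r )
    where
    cone△-elim′ : ∀ q → q ≢ r → new s q ∈△ new r
    cone△-elim′ q q≢r with q Finₚ.≟ s
    ... | yes ≡.refl = ≡.subst (_∈△ new r) (≡.sym (cone△-apex (t j) s)) (apex∈cone△ (t j) r)
    ... | no  q≢s    = ≡.subst (_∈△ new r) (≡.sym (cone△-base (t j) s q≢s)) (base∈cone△ (t j) r q≢r)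

  old-neighbour : ∀ k s → ∃ λ l → Adjacent (old k) s (stack△ t j l)
  old-neighbour k s with neighbour (punchIn j k) s
  ... | l , tks∉tl , rest with l Finₚ.≟ j
  ... | no l≢j = in-old (old k) s l l≢j
                   (lift∉ (t l) tks∉tl , λ r r≢s → lift∈ (t l) (rest r r≢s))
  -- The old neighbour was the removed triangle. Its corner `q` outside `t k` names the new triangle
  -- erected on the common edge.
  ... | yes ≡.refl =
    let q , tjq∉tk = distinct j (punchIn j k) (Finₚ.punchInᵢ≢i j k ∘ ≡.sym)
    in in-new (old k) s q
         ( base∉cone△ (t j) q (λ r _ eq → tks∉tl (r , eq))
         , λ r r≢s → let p , tjp≡tkr = rest r r≢s
                     in ≡.subst (λ i → suc i ∈△ new q) tjp≡tkr
                          (base∈cone△ (t j) q λ p≡q → tjq∉tk (r , ≡.trans (≡.sym tjp≡tkr) (≡.cong (t _) p≡q))) )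

tetrahedron : Fin 4 → Triangle 4
tetrahedron = punchIn

tetrahedron-isTriangulation : IsTriangulation tetrahedron
tetrahedron-isTriangulation = record
  { distinct  = λ j k j≢k → punchOut j≢k ,
      ≡.subst (_∉△ punchIn k) (≡.sym (Finₚ.punchIn-punchOut j≢k)) (λ { (s , eq) → Finₚ.punchInᵢ≢i k s eq })
  ; neighbour = λ j s → punchIn j s , (λ { (r , eq) → Finₚ.punchInᵢ≢i _ r eq })
      , λ r r≢s → let ≢ = λ eq → r≢s (≡.sym (Finₚ.punchIn-injective j s r eq)) in punchOut ≢ , Finₚ.punchIn-punchOut ≢
  }

-- Ordered fields and rational numbers

module OrderedField {c ℓ} (ℝ : RealNumbers c ℓ) where

  open Koebe ℝ
  open RealNumbers ℝ hiding (zero)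
  open IsStrictTotalOrder isStrictTotalOrder public
    using (compare; _≟_; irrefl; asym; <-resp-≈)
    renaming (trans to <-trans)
  open RingProperties ring public using (-0#≈0#)
  open AbelianGroupProperties +-abelianGroup public using () renaming (⁻¹-involutive to -‿involutive)
  open Mult semiring renaming (_×_ to _×ᵒ_) using (×ᵤ≈×; 1+×; ×-homo-+; ×1-homo-*)
  module ≈-Reasoning = SetoidReasoning setoid
  open ≈-Reasoning

  -- Like `fromℤ`, but with the multiplication for which `ι (+ 1)` reduces to `1#`; the solver and
  -- the sign lemmas below rely on this reduction.
  ι : ℤ → Carrier
  ι (+ n)    = n ×ᵒ 1#
  ι -[1+ n ] = - (suc n ×ᵒ 1#)

  private
    cancel-1 : ∀ x y → x + - y ≈ (1# + x) + - (1# + y)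
    cancel-1 x y = sym (begin
      (1# + x) + - (1# + y)      ≈⟨ +-cong (+-comm 1# x) (-‿cong (refl {1# + y})) ⟩
      (x + 1#) + - (1# + y)      ≈⟨ +-congˡ (AbelianGroupProperties.⁻¹-∙-comm +-abelianGroup 1# y) ⟨
      (x + 1#) + (- 1# + - y)    ≈⟨ +-assoc x 1# _ ⟩
      x + (1# + (- 1# + - y))    ≈⟨ +-congˡ (+-assoc 1# (- 1#) (- y)) ⟨
      x + ((1# + - 1#) + - y)    ≈⟨ +-congˡ (+-congʳ (-‿inverseʳ 1#)) ⟩
      x + (0# + - y)             ≈⟨ +-congˡ (+-identityˡ (- y)) ⟩
      x + - y                    ∎)

  ι-⊖ : ∀ m n → ι (m ⊖ n) ≈ m ×ᵒ 1# + - (n ×ᵒ 1#)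
  ι-⊖ zero    zero    = sym (-‿inverseʳ 0#)
  ι-⊖ (suc m) zero    = sym (trans (+-congˡ -0#≈0#) (+-identityʳ _))
  ι-⊖ zero    (suc n) = sym (+-identityˡ _)
  ι-⊖ (suc m) (suc n) = begin
    ι (suc m ⊖ suc n)                       ≡⟨ ≡.cong ι (ℤₚ.[1+m]⊖[1+n]≡m⊖n m n) ⟩
    ι (m ⊖ n)                               ≈⟨ ι-⊖ m n ⟩
    m ×ᵒ 1# + - (n ×ᵒ 1#)                   ≈⟨ cancel-1 _ _ ⟩
    (1# + m ×ᵒ 1#) + - (1# + n ×ᵒ 1#)       ≈⟨ +-cong (1+× m 1#) (-‿cong (1+× n 1#)) ⟨
    suc m ×ᵒ 1# + - (suc n ×ᵒ 1#)           ∎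

  ι-homo-neg : ∀ z → ι (ℤ.- z) ≈ - ι z
  ι-homo-neg (+ zero)  = sym -0#≈0#
  ι-homo-neg (+ suc n) = refl
  ι-homo-neg -[1+ n ]  = sym (-‿involutive _)

  ι-homo-+ : ∀ x y → ι (x ℤ.+ y) ≈ ι x + ι y
  ι-homo-+ (+ m)    (+ n)    = ×-homo-+ 1# m n
  ι-homo-+ (+ m)    -[1+ n ] = ι-⊖ m (suc n)
  ι-homo-+ -[1+ m ] (+ n)    = trans (ι-⊖ n (suc m)) (+-comm _ _)
  ι-homo-+ -[1+ m ] -[1+ n ] = begin
    - (suc (suc (m ℕ.+ n)) ×ᵒ 1#)                ≡⟨ ≡.cong (λ k → - (suc k ×ᵒ 1#)) (ℕ-suc m n) ⟩
    - ((suc m ℕ.+ suc n) ×ᵒ 1#)                  ≈⟨ -‿cong (×-homo-+ 1# (suc m) (suc n)) ⟩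
    - (suc m ×ᵒ 1# + suc n ×ᵒ 1#)                ≈⟨ AbelianGroupProperties.⁻¹-∙-comm +-abelianGroup _ _ ⟨
    - (suc m ×ᵒ 1#) + - (suc n ×ᵒ 1#)            ∎
    where
    ℕ-suc : ∀ m n → suc (m ℕ.+ n) ≡ m ℕ.+ suc n
    ℕ-suc zero    n = ≡.refl
    ℕ-suc (suc m) n = ≡.cong suc (ℕ-suc m n)

  private
    neg-*ˡ = RingProperties.-‿distribˡ-* ring
    neg-*ʳ = RingProperties.-‿distribʳ-* ring

  ι-homo-* : ∀ x y → ι (x ℤ.* y) ≈ ι x * ι y
  ι-homo-* (+ m)    (+ n)    = trans (reflexive (≡.cong ι (ℤₚ.+◃n≡+n (m ℕ.* n)))) (×1-homo-* m n)
  ι-homo-* (+ m)    -[1+ n ] = begin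
    ι (Sign.- ◃ m ℕ.* suc n)         ≡⟨ ≡.cong ι (ℤₚ.-◃n≡-n (m ℕ.* suc n)) ⟩
    ι (ℤ.- (+ (m ℕ.* suc n)))        ≈⟨ ι-homo-neg (+ (m ℕ.* suc n)) ⟩
    - ((m ℕ.* suc n) ×ᵒ 1#)          ≈⟨ -‿cong (×1-homo-* m (suc n)) ⟩
    - (m ×ᵒ 1# * (suc n ×ᵒ 1#))      ≈⟨ neg-*ʳ _ _ ⟩
    m ×ᵒ 1# * - (suc n ×ᵒ 1#)        ∎
  ι-homo-* -[1+ m ] (+ n)    = begin
    ι (Sign.- ◃ suc m ℕ.* n)         ≡⟨ ≡.cong ι (ℤₚ.-◃n≡-n (suc m ℕ.* n)) ⟩
    ι (ℤ.- (+ (suc m ℕ.* n)))        ≈⟨ ι-homo-neg (+ (suc m ℕ.* n)) ⟩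
    - ((suc m ℕ.* n) ×ᵒ 1#)          ≈⟨ -‿cong (×1-homo-* (suc m) n) ⟩
    - (suc m ×ᵒ 1# * (n ×ᵒ 1#))      ≈⟨ neg-*ˡ _ _ ⟩
    - (suc m ×ᵒ 1#) * (n ×ᵒ 1#)      ∎
  ι-homo-* -[1+ m ] -[1+ n ] = begin
    (suc m ℕ.* suc n) ×ᵒ 1#                 ≈⟨ ×1-homo-* (suc m) (suc n) ⟩
    suc m ×ᵒ 1# * (suc n ×ᵒ 1#)             ≈⟨ -‿involutive _ ⟨
    - - (suc m ×ᵒ 1# * (suc n ×ᵒ 1#))       ≈⟨ -‿cong (neg-*ˡ _ _) ⟩
    - (- (suc m ×ᵒ 1#) * (suc n ×ᵒ 1#))     ≈⟨ neg-*ʳ _ _ ⟩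
    - (suc m ×ᵒ 1#) * - (suc n ×ᵒ 1#)       ∎

  private
    ℤ-rawRing : RawRing _ _
    ℤ-rawRing = record
      { Carrier = ℤ ; _≈_ = _≡_ ; _+_ = ℤ._+_ ; _*_ = ℤ._*_ ; -_ = ℤ.-_ ; 0# = + 0 ; 1# = + 1 }

    -- Coefficients of the solver live in ℤ, where they are compared by evaluation; numerical
    -- identities can then be closed by `solve 0`.
    ι-morphism : ℤ-rawRing -Raw-AlmostCommutative⟶ fromCommutativeRing commutativeRing
    ι-morphism = record
      { ⟦_⟧ = ι ; +-homo = ι-homo-+ ; *-homo = ι-homo-* ; -‿homo = ι-homo-neg
      ; 0-homo = refl ; 1-homo = refl }

    ι-≟ : ∀ x y → Maybe (ι x ≈ ι y)
    ι-≟ x y with x ℤₚ.≟ y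
    ... | yes x≡y = just (reflexive (≡.cong ι x≡y))
    ... | no  _   = nothing

  open RingSolver ℤ-rawRing (fromCommutativeRing commutativeRing) ι-morphism ι-≟ public
    using (solve; _:=_; _:+_; _:*_; _:-_; :-_; con)

  private module ≤ = NonStrict _≈_ _<_

  ≤-trans : ∀ {x y z} → x ≤ y → y ≤ z → x ≤ z
  ≤-trans = ≤.trans isEquivalence <-resp-≈ <-trans

  <-≤-trans : ∀ {x y z} → x < y → y ≤ z → x < z
  <-≤-trans = ≤.<-≤-trans <-trans (proj₁ <-resp-≈)

  ≤-<-trans : ∀ {x y z} → x ≤ y → y < z → x < z
  ≤-<-trans = ≤.≤-<-trans sym <-trans (proj₂ <-resp-≈)

  <-respʳ : ∀ {x y z} → y ≈ z → x < y → x < z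
  <-respʳ = proj₁ <-resp-≈

  <-respˡ : ∀ {x y z} → y ≈ z → y < x → z < x
  <-respˡ = proj₂ <-resp-≈

  ≤-respʳ : ∀ {x y z} → y ≈ z → x ≤ y → x ≤ z
  ≤-respʳ y≈z x≤y = ≤-trans x≤y (inj₂ y≈z)

  ≤-respˡ : ∀ {x y z} → y ≈ z → y ≤ x → z ≤ x
  ≤-respˡ y≈z y≤x = ≤-trans (inj₂ (sym y≈z)) y≤x

  ≤⇒≯ : ∀ {x y} → x ≤ y → ¬ (y < x)
  ≤⇒≯ x≤y y<x = irrefl refl (≤-<-trans x≤y y<x)

  <⇒≉ : ∀ {x y} → x < y → x ≉ y
  <⇒≉ x<y x≈y = irrefl x≈y x<y

  ≤∧≉⇒< : ∀ {x y} → x ≤ y → x ≉ y → x < y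
  ≤∧≉⇒< (inj₁ x<y) _   = x<y
  ≤∧≉⇒< (inj₂ x≈y) x≉y = contradiction x≈y x≉y

  +-mono-<-≤ : ∀ {w x y z} → w < x → y ≤ z → w + y < x + z
  +-mono-<-≤ {x = x} w<x (inj₂ y≈z) = <-respʳ (+-congˡ y≈z) (+-monoˡ-< _ w<x)
  +-mono-<-≤ {x = x} {y} {z} w<x (inj₁ y<z) =
    <-trans (+-monoˡ-< y w<x) (<-respˡ (+-comm y x) (<-respʳ (+-comm z x) (+-monoˡ-< x y<z)))

  +-mono-≤ : ∀ {w x y z} → w ≤ x → y ≤ z → w + y ≤ x + z
  +-mono-≤ (inj₁ w<x) y≤z        = inj₁ (+-mono-<-≤ w<x y≤z)
  +-mono-≤ (inj₂ w≈x) (inj₂ y≈z) = inj₂ (+-cong w≈x y≈z)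
  +-mono-≤ {w} {x} {y} {z} (inj₂ w≈x) (inj₁ y<z) =
    inj₁ (<-respˡ (+-comm y w) (<-respʳ (+-comm z x) (+-mono-<-≤ y<z (inj₂ w≈x))))

  pos+nonneg : ∀ {x y} → 0# < x → 0# ≤ y → 0# < x + y
  pos+nonneg 0<x 0≤y = <-respˡ (+-identityˡ 0#) (+-mono-<-≤ 0<x 0≤y)

  neg+nonpos : ∀ {x y} → x < 0# → y ≤ 0# → x + y < 0#
  neg+nonpos x<0 y≤0 = <-respʳ (+-identityˡ 0#) (+-mono-<-≤ x<0 y≤0)

  nonneg+nonneg : ∀ {x y} → 0# ≤ x → 0# ≤ y → 0# ≤ x + y
  nonneg+nonneg 0≤x 0≤y = ≤-respˡ (+-identityˡ 0#) (+-mono-≤ 0≤x 0≤y)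

  nonpos+nonpos : ∀ {x y} → x ≤ 0# → y ≤ 0# → x + y ≤ 0#
  nonpos+nonpos x≤0 y≤0 = ≤-respʳ (+-identityˡ 0#) (+-mono-≤ x≤0 y≤0)

  nonpos+nonpos≈0 : ∀ {x y} → x ≤ 0# → y ≤ 0# → x + y ≈ 0# → x ≈ 0# × y ≈ 0#
  nonpos+nonpos≈0 {x} {y} (inj₁ x<0) y≤0 x+y≈0 = contradiction x+y≈0 (<⇒≉ (neg+nonpos x<0 y≤0))
  nonpos+nonpos≈0 {x} {y} (inj₂ x≈0) y≤0 x+y≈0 =
    x≈0 , trans (sym (trans (+-congʳ x≈0) (+-identityˡ y))) x+y≈0

  neg⇒pos : ∀ {x} → x < 0# → 0# < - x
  neg⇒pos {x} x<0 = <-respˡ (-‿inverseʳ x) (<-respʳ (+-identityˡ (- x)) (+-monoˡ-< (- x) x<0))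

  pos⇒neg : ∀ {x} → 0# < x → - x < 0#
  pos⇒neg {x} 0<x = <-respʳ (-‿inverseʳ x) (<-respˡ (+-identityˡ (- x)) (+-monoˡ-< (- x) 0<x))

  neg-pos⇒neg : ∀ {x} → 0# < - x → x < 0#
  neg-pos⇒neg {x} 0<-x = <-respˡ (-‿involutive x) (pos⇒neg 0<-x)

  nonpos⇒nonneg : ∀ {x} → x ≤ 0# → 0# ≤ - x
  nonpos⇒nonneg (inj₁ x<0) = inj₁ (neg⇒pos x<0)
  nonpos⇒nonneg (inj₂ x≈0) = inj₂ (sym (trans (-‿cong x≈0) -0#≈0#))

  pos*neg : ∀ {x y} → 0# < x → y < 0# → x * y < 0#
  pos*neg {x} {y} 0<x y<0 = neg-pos⇒neg (<-respʳ (sym (neg-*ʳ x y)) (*-pos 0<x (neg⇒pos y<0)))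

  nonneg*nonpos : ∀ {x y} → 0# ≤ x → y ≤ 0# → x * y ≤ 0#
  nonneg*nonpos (inj₁ 0<x) (inj₁ y<0) = inj₁ (pos*neg 0<x y<0)
  nonneg*nonpos {x} (inj₁ 0<x) (inj₂ y≈0) = inj₂ (trans (*-congˡ y≈0) (zeroʳ x))
  nonneg*nonpos {x} {y} (inj₂ 0≈x) _ = inj₂ (trans (*-congʳ (sym 0≈x)) (zeroˡ y))

  nonneg*nonneg : ∀ {x y} → 0# ≤ x → 0# ≤ y → 0# ≤ x * y
  nonneg*nonneg (inj₁ 0<x) (inj₁ 0<y) = inj₁ (*-pos 0<x 0<y)
  nonneg*nonneg {x} (inj₁ 0<x) (inj₂ 0≈y) = inj₂ (sym (trans (*-congˡ (sym 0≈y)) (zeroʳ x)))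
  nonneg*nonneg {x} {y} (inj₂ 0≈x) _ = inj₂ (sym (trans (*-congʳ (sym 0≈x)) (zeroˡ y)))

  sum+neg⇒neg : ∀ {x y} → x + y < 0# → x < 0# ⊎ y < 0#
  sum+neg⇒neg {x} {y} x+y<0 with compare x 0# | compare y 0#
  ... | tri< x<0 _ _ | _            = inj₁ x<0
  ... | _            | tri< y<0 _ _ = inj₂ y<0
  ... | tri≈ _ x≈0 _ | tri≈ _ y≈0 _ = contradiction x+y<0 (≤⇒≯ (nonneg+nonneg (inj₂ (sym x≈0)) (inj₂ (sym y≈0))))
  ... | tri≈ _ x≈0 _ | tri> _ _ 0<y = contradiction x+y<0 (≤⇒≯ (nonneg+nonneg (inj₂ (sym x≈0)) (inj₁ 0<y)))
  ... | tri> _ _ 0<x | tri≈ _ y≈0 _ = contradiction x+y<0 (≤⇒≯ (nonneg+nonneg (inj₁ 0<x) (inj₂ (sym y≈0))))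
  ... | tri> _ _ 0<x | tri> _ _ 0<y = contradiction x+y<0 (≤⇒≯ (nonneg+nonneg (inj₁ 0<x) (inj₁ 0<y)))

  infix 8 _⁻¹⟨_⟩
  _⁻¹⟨_⟩ : ∀ x → x ≉ 0# → Carrier
  x ⁻¹⟨ x≉0 ⟩ = proj₁ (inverse x x≉0)

  *-inverseʳ : ∀ x (x≉0 : x ≉ 0#) → x * x ⁻¹⟨ x≉0 ⟩ ≈ 1#
  *-inverseʳ x x≉0 = proj₂ (inverse x x≉0)

  *-inverseˡ : ∀ x (x≉0 : x ≉ 0#) → x ⁻¹⟨ x≉0 ⟩ * x ≈ 1#
  *-inverseˡ x x≉0 = trans (*-comm _ _) (*-inverseʳ x x≉0)

  1≉0 : 1# ≉ 0#
  1≉0 1≈0 = <⇒≉ 0<1 (sym 1≈0)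

  x*y≈0⇒y≈0 : ∀ {x y} → x ≉ 0# → x * y ≈ 0# → y ≈ 0#
  x*y≈0⇒y≈0 {x} {y} x≉0 xy≈0 = begin
    y                          ≈⟨ *-identityˡ y ⟨
    1# * y                     ≈⟨ *-congʳ (*-inverseˡ x x≉0) ⟨
    x ⁻¹⟨ x≉0 ⟩ * x * y        ≈⟨ *-assoc _ _ _ ⟩
    x ⁻¹⟨ x≉0 ⟩ * (x * y)      ≈⟨ *-congˡ xy≈0 ⟩
    x ⁻¹⟨ x≉0 ⟩ * 0#           ≈⟨ zeroʳ _ ⟩
    0#                         ∎

  x*y≉0 : ∀ {x y} → x ≉ 0# → y ≉ 0# → x * y ≉ 0#
  x*y≉0 x≉0 y≉0 xy≈0 = y≉0 (x*y≈0⇒y≈0 x≉0 xy≈0)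

  inverse-pos : ∀ {x} (0<x : 0# < x) (x≉0 : x ≉ 0#) → 0# < x ⁻¹⟨ x≉0 ⟩
  inverse-pos {x} 0<x x≉0 with compare (x ⁻¹⟨ x≉0 ⟩) 0#
  ... | tri> _ _ 0<y = 0<y
  ... | tri< y<0 _ _ = contradiction 0<1 (asym (<-respˡ (*-inverseʳ x x≉0) (pos*neg 0<x y<0)))
  ... | tri≈ _ y≈0 _ = contradiction (trans (sym (*-inverseʳ x x≉0)) (trans (*-congˡ y≈0) (zeroʳ x))) 1≉0

  fromℤ≈ι : ∀ z → fromℤ z ≈ ι z
  fromℤ≈ι (+ n)    = ×ᵤ≈× n 1#
  fromℤ≈ι -[1+ n ] = -‿cong (×ᵤ≈× (suc n) 1#)

  suc×1>0 : ∀ n → 0# < suc n ×ᵒ 1#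
  suc×1>0 zero    = 0<1
  suc×1>0 (suc n) = pos+nonneg (suc×1>0 n) (inj₁ 0<1)

  rational⁺ : ∀ {x} d p → ι (+ suc d) * x ≈ ι p → Rational x
  rational⁺ d p eq = mkℚᵘ p d , trans (*-congʳ (fromℤ≈ι (+ suc d))) (trans eq (sym (fromℤ≈ι p)))

  rational⁻ : ∀ {x} → Rational x → ∃₂ λ d p → ι (+ suc d) * x ≈ ι p
  rational⁻ (mkℚᵘ p d , eq) = d , p , trans (*-congʳ (sym (fromℤ≈ι (+ suc d)))) (trans eq (fromℤ≈ι p))

  rational-ι : ∀ z → Rational (ι z)
  rational-ι z = rational⁺ 0 z (*-identityˡ _)

  rational-resp : ∀ {x y} → x ≈ y → Rational x → Rational y
  rational-resp x≈y (q , eq) = q , trans (*-congˡ (sym x≈y)) eq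

  rational-+ : ∀ {x y} → Rational x → Rational y → Rational (x + y)
  rational-+ {x} {y} rx ry =
    let d , p , dx≈p = rational⁻ rx
        e , q , ey≈q = rational⁻ ry
        D = + suc d
        E = + suc e
    -- `mkℚᵘ` stores the denominator less one, and the successor of `e + d * suc e` is
    -- definitionally `suc d * suc e`.
    in rational⁺ (e ℕ.+ d ℕ.* suc e) (E ℤ.* p ℤ.+ D ℤ.* q) (begin
         ι (D ℤ.* E) * (x + y)                 ≈⟨ *-congʳ (ι-homo-* D E) ⟩
         ι D * ι E * (x + y)                   ≈⟨ solve 4 (λ a b x y → a :* b :* (x :+ y) := b :* (a :* x) :+ a :* (b :* y)) refl (ι D) (ι E) x y ⟩
         ι E * (ι D * x) + ι D * (ι E * y)     ≈⟨ +-cong (*-congˡ dx≈p) (*-congˡ ey≈q) ⟩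
         ι E * ι p + ι D * ι q                 ≈⟨ +-cong (ι-homo-* E p) (ι-homo-* D q) ⟨
         ι (E ℤ.* p) + ι (D ℤ.* q)             ≈⟨ ι-homo-+ (E ℤ.* p) (D ℤ.* q) ⟨
         ι (E ℤ.* p ℤ.+ D ℤ.* q)               ∎)

  rational-neg : ∀ {x} → Rational x → Rational (- x)
  rational-neg {x} rx =
    let d , p , dx≈p = rational⁻ rx
    in rational⁺ d (ℤ.- p) (begin
         ι (+ suc d) * - x       ≈⟨ neg-*ʳ _ x ⟨
         - (ι (+ suc d) * x)     ≈⟨ -‿cong dx≈p ⟩
         - ι p                   ≈⟨ ι-homo-neg p ⟨
         ι (ℤ.- p)               ∎)

  rational-* : ∀ {x y} → Rational x → Rational y → Rational (x * y)
  rational-* {x} {y} rx ry =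
    let d , p , dx≈p = rational⁻ rx
        e , q , ey≈q = rational⁻ ry
        D = + suc d
        E = + suc e
    in rational⁺ (e ℕ.+ d ℕ.* suc e) (p ℤ.* q) (begin
         ι (D ℤ.* E) * (x * y)           ≈⟨ *-congʳ (ι-homo-* D E) ⟩
         ι D * ι E * (x * y)             ≈⟨ solve 4 (λ a b x y → a :* b :* (x :* y) := (a :* x) :* (b :* y)) refl (ι D) (ι E) x y ⟩
         (ι D * x) * (ι E * y)           ≈⟨ *-cong dx≈p ey≈q ⟩
         ι p * ι q                       ≈⟨ ι-homo-* p q ⟨
         ι (p ℤ.* q)                     ∎)

  rational-invert : ∀ {x y} → Rational x → x * y ≈ 1# → Rational y
  rational-invert {x} {y} rx xy≈1 = go (rational⁻ rx)
    where
    py≈d : ∀ d p → ι (+ suc d) * x ≈ ι p → ι p * y ≈ ι (+ suc d)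
    py≈d d p dx≈p = begin
      ι p * y                  ≈⟨ *-congʳ dx≈p ⟨
      ι (+ suc d) * x * y      ≈⟨ *-assoc _ x y ⟩
      ι (+ suc d) * (x * y)    ≈⟨ *-congˡ xy≈1 ⟩
      ι (+ suc d) * 1#         ≈⟨ *-identityʳ _ ⟩
      ι (+ suc d)              ∎
    go : (∃₂ λ d p → ι (+ suc d) * x ≈ ι p) → Rational y
    go (d , + zero , eq) =
      contradiction (trans (sym (zeroˡ y)) (py≈d d (+ 0) eq)) (<⇒≉ (suc×1>0 d))
    go (d , + suc k , eq) = rational⁺ k (+ suc d) (py≈d d (+ suc k) eq)
    -- Denominators are positive, so the sign of the old numerator moves to the new one.
    go (d , -[1+ k ] , eq) = rational⁺ k -[1+ d ] (begin
      ι (+ suc k) * y          ≈⟨ -‿involutive _ ⟨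
      - - (ι (+ suc k) * y)    ≈⟨ -‿cong (neg-*ˡ _ y) ⟩
      - (ι -[1+ k ] * y)       ≈⟨ -‿cong (py≈d d -[1+ k ] eq) ⟩
      ι -[1+ d ]               ∎)

-- Linear algebra and cones

module LinearAlgebra {c ℓ} (ℝ : RealNumbers c ℓ) where

  open Koebe ℝ
  open RealNumbers ℝ hiding (zero)
  open OrderedField ℝ
  open ≈-Reasoning
  open RingProperties ring using (-1*x≈-x)
  open SemiringSum semiring using (sum; sum-cong-≋; sum-remove; ∑-distrib-+; ∑-comm; sum-replicate-zero; *-distribˡ-sum; *-distribʳ-sum) public

  V : ℕ → Set c
  V d = Vector Carrier d

  infixl 6 _⊕_
  infixl 7 _⊙_

  _⊕_ : ∀ {d} → V d → V d → V d
  (u ⊕ v) k = u k + v k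

  _⊙_ : ∀ {d} → Carrier → V d → V d
  (a ⊙ u) k = a * u k

  infix 4 _≗_
  _≗_ : ∀ {d} → V d → V d → Set ℓ
  u ≗ v = ∀ k → u k ≈ v k

  comb : ∀ {n d} → V n → (Fin n → V d) → V d
  comb t w k = sum (λ i → t i * w i k)

  dot : ∀ {d} → V d → V d → Carrier
  dot u v = sum (λ k → u k * v k)

  sum-zero : ∀ {n} {t : V n} → (∀ i → t i ≈ 0#) → sum t ≈ 0#
  sum-zero {n} t≈0 = trans (sum-cong-≋ t≈0) (sum-replicate-zero n)

  sum-single : ∀ {n} i {t : V n} → (∀ j → j ≢ i → t j ≈ 0#) → sum t ≈ t i
  sum-single {suc n} i {t} others = begin
    sum t                      ≈⟨ sum-remove {i = i} t ⟩
    t i + sum (removeAt t i)   ≈⟨ +-congˡ (sum-zero λ j → others (punchIn i j) (Finₚ.punchInᵢ≢i i j)) ⟩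
    t i + 0#                   ≈⟨ +-identityʳ _ ⟩
    t i                        ∎

  sum-nonpos : ∀ {n} {t : V n} → (∀ i → t i ≤ 0#) → sum t ≤ 0#
  sum-nonpos {zero}  t≤0 = inj₂ refl
  sum-nonpos {suc n} t≤0 = nonpos+nonpos (t≤0 zero) (sum-nonpos (t≤0 ∘ suc))

  sum-nonpos≈0 : ∀ {n} {t : V n} → (∀ i → t i ≤ 0#) → sum t ≈ 0# → ∀ i → t i ≈ 0#
  sum-nonpos≈0 {suc n} t≤0 ∑t≈0 zero    = proj₁ (nonpos+nonpos≈0 (t≤0 zero) (sum-nonpos (t≤0 ∘ suc)) ∑t≈0)
  sum-nonpos≈0 {suc n} t≤0 ∑t≈0 (suc i) =
    sum-nonpos≈0 (t≤0 ∘ suc) (proj₂ (nonpos+nonpos≈0 (t≤0 zero) (sum-nonpos (t≤0 ∘ suc)) ∑t≈0)) i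

  dot-cong : ∀ {d} {u u′ v v′ : V d} → u ≗ u′ → v ≗ v′ → dot u v ≈ dot u′ v′
  dot-cong u≗u′ v≗v′ = sum-cong-≋ λ k → *-cong (u≗u′ k) (v≗v′ k)

  dot-comm : ∀ {d} (u v : V d) → dot u v ≈ dot v u
  dot-comm u v = sum-cong-≋ λ k → *-comm (u k) (v k)

  dot-⊕ˡ : ∀ {d} (u v w : V d) → dot (u ⊕ v) w ≈ dot u w + dot v w
  dot-⊕ˡ u v w = trans (sum-cong-≋ λ k → distribʳ (w k) (u k) (v k)) (∑-distrib-+ (λ k → u k * w k) (λ k → v k * w k))

  dot-⊙ˡ : ∀ {d} a (u w : V d) → dot (a ⊙ u) w ≈ a * dot u w
  dot-⊙ˡ a u w = trans (sum-cong-≋ λ k → *-assoc a (u k) (w k)) (sym (*-distribˡ-sum a (λ k → u k * w k)))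

  dot-⊙ʳ : ∀ {d} a (w u : V d) → dot w (a ⊙ u) ≈ a * dot w u
  dot-⊙ʳ a w u = trans (dot-comm w (a ⊙ u)) (trans (dot-⊙ˡ a u w) (*-congˡ (dot-comm u w)))

  dot-0ˡ : ∀ {d} {u : V d} → (∀ k → u k ≈ 0#) → ∀ w → dot u w ≈ 0#
  dot-0ˡ u≈0 w = sum-zero λ k → trans (*-congʳ (u≈0 k)) (zeroˡ (w k))

  dot-combˡ : ∀ {n d} (t : V n) (w : Fin n → V d) v → dot (comb t w) v ≈ sum (λ i → t i * dot (w i) v)
  dot-combˡ t w v = begin
    sum (λ k → sum (λ i → t i * w i k) * v k)        ≈⟨ sum-cong-≋ (λ k → *-distribʳ-sum (v k) (λ i → t i * w i k)) ⟩
    sum (λ k → sum (λ i → t i * w i k * v k))        ≈⟨ ∑-comm (λ k i → t i * w i k * v k) ⟩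
    sum (λ i → sum (λ k → t i * w i k * v k))        ≈⟨ sum-cong-≋ (λ i → dot-⊙ˡ (t i) (w i) v) ⟩
    sum (λ i → t i * dot (w i) v)                    ∎

  dot-combʳ : ∀ {n d} v (t : V n) (w : Fin n → V d) → dot v (comb t w) ≈ sum (λ i → t i * dot v (w i))
  dot-combʳ v t w = begin
    dot v (comb t w)                   ≈⟨ dot-comm v (comb t w) ⟩
    dot (comb t w) v                   ≈⟨ dot-combˡ t w v ⟩
    sum (λ i → t i * dot (w i) v)      ≈⟨ sum-cong-≋ (λ i → *-congˡ (dot-comm (w i) v)) ⟩
    sum (λ i → t i * dot v (w i))      ∎

  Independent : ∀ {n d} → (Fin n → V d) → Set (c ⊔ ℓ)
  Independent w = ∀ t → (∀ k → comb t w k ≈ 0#) → ∀ i → t i ≈ 0#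

  -- Gaussian elimination on the coordinate `zero`. If it vanishes throughout, one vector is dropped
  -- along with the coordinate. Otherwise a pivot `a` is used without division: the other vectors
  -- are multiplied by `a`, and the coefficient `- S` of the pivot vector restores the multiples of
  -- it that were subtracted.
  dependent : ∀ {n} (w : Fin (suc n) → V n) → ∃ λ t → (∃ λ i → t i ≉ 0#) × ∀ k → comb t w k ≈ 0#
  dependent {zero}  w = const 1# , (zero , 1≉0) , λ ()
  dependent {suc n} w with Finₚ.any? (λ i → ¬? (w i zero ≟ 0#))
  ... | no none =
    let w₀≈0 = λ i → decidable-stable (w i zero ≟ 0#) (λ w≉0 → none (i , w≉0))
        t , (i , ti≉0) , eq = dependent (λ i → w (suc i) ∘ suc)
        t′ = 0# ∷ t
        zeros = λ where
          zero    → sum-zero λ i → trans (*-congˡ (w₀≈0 i)) (zeroʳ (t′ i))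
          (suc k) → trans (+-congʳ (zeroˡ _)) (trans (+-identityˡ _) (eq k))
    in t′ , (suc i , ti≉0) , zeros
  ... | yes (p , a≉0) = t , (punchIn p i , ti≉0) , zeros
    where
    a = w p zero
    x = λ i → w (punchIn p i)
    ih = dependent (λ i k → x i (suc k) * a + - (x i zero * w p (suc k)))
    t′ = proj₁ ih
    i  = proj₁ (proj₁ (proj₂ ih))
    S  = sum (λ i → t′ i * x i zero)
    t  = insertAt (λ i → t′ i * a) p (- S)
    ti≉0 : t (punchIn p i) ≉ 0#
    ti≉0 eq = x*y≉0 (proj₂ (proj₁ (proj₂ ih))) a≉0 (trans (reflexive (≡.sym (insertAt-punchIn _ p _ i))) eq)
    eliminated : ∀ k → sum (λ i → t′ i * (x i k * a + - (x i zero * w p k))) ≈ 0#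
    eliminated zero    = sum-zero λ i →
      solve 3 (λ t x a → t :* (x :* a :- x :* a) := con ℤ.0ℤ) refl (t′ i) (x i zero) a
    eliminated (suc k) = proj₂ (proj₂ ih) k
    zeros : ∀ k → comb t w k ≈ 0#
    zeros k = begin
      comb t w k
        ≈⟨ sum-remove {i = p} (λ i → t i * w i k) ⟩
      t p * w p k + sum (λ i → t (punchIn p i) * x i k)
        ≈⟨ +-cong (*-congʳ (reflexive (insertAt-lookup _ p _)))
             (sum-cong-≋ λ i → *-congʳ {x i k} (reflexive (insertAt-punchIn (λ i → t′ i * a) p (- S) i))) ⟩
      - S * w p k + sum (λ i → t′ i * a * x i k)
        ≈⟨ +-congʳ (solve 2 (λ s y → :- s :* y := s :* :- y) refl S (w p k)) ⟩
      S * - w p k + sum (λ i → t′ i * a * x i k)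
        ≈⟨ +-congʳ (*-distribʳ-sum (- w p k) (λ i → t′ i * x i zero)) ⟩
      sum (λ i → t′ i * x i zero * - w p k) + sum (λ i → t′ i * a * x i k)
        ≈⟨ ∑-distrib-+ (λ i → t′ i * x i zero * - w p k) (λ i → t′ i * a * x i k) ⟨
      sum (λ i → t′ i * x i zero * - w p k + t′ i * a * x i k)
        ≈⟨ sum-cong-≋ (λ i → solve 5 (λ t x₀ y a x → t :* x₀ :* :- y :+ t :* a :* x := t :* (x :* a :- x₀ :* y)) refl
             (t′ i) (x i zero) (w p k) a (x i k)) ⟩
      sum (λ i → t′ i * (x i k * a + - (x i zero * w p k)))
        ≈⟨ eliminated k ⟩
      0# ∎

  -- If g k ≉ 0 then the vectors w i lie in the graph of a function of the
  -- coordinates other than k, so they are as dependent as their projections.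
  vanishing : ∀ {n} {w : Fin (suc n) → V (suc n)} → Independent w →
              ∀ g → (∀ i → dot g (w i) ≈ 0#) → ∀ k → g k ≈ 0#
  vanishing {w = w} ind g gw≈0 k with g k ≟ 0#
  ... | yes gk≈0 = gk≈0
  ... | no  gk≉0 =
    let t , (i , ti≉0) , eq = dependent (λ i → removeAt (w i) k)
        g-comb = begin
          g k * comb t w k                                            ≈⟨ +-identityʳ _ ⟨
          g k * comb t w k + 0#                                       ≈⟨ +-congˡ (sum-zero λ j → trans (*-congˡ (eq j)) (zeroʳ _)) ⟨
          g k * comb t w k + sum (removeAt (λ k → g k * comb t w k) k) ≈⟨ sum-remove {i = k} (λ k → g k * comb t w k) ⟨
          dot g (comb t w)                                            ≈⟨ dot-combʳ g t w ⟩
          sum (λ i → t i * dot g (w i))                               ≈⟨ sum-zero (λ i → trans (*-congˡ (gw≈0 i)) (zeroʳ (t i))) ⟩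
          0#                                                          ∎
        eqₖ : comb t w k ≈ 0#
        eqₖ = x*y≈0⇒y≈0 gk≉0 g-comb
    in contradiction (ind t (punchIn-elim (λ k → comb t w k ≈ 0#) k eqₖ eq) i) ti≉0

  -- The vectors other than `w j` form a matrix with `suc n` rows of length `n`; a dependency among
  -- the rows is a functional killing these vectors. By `vanishing` it cannot kill `w j` as well,
  -- and its sign can be chosen.
  dual-functional : ∀ {n} {w : Fin (suc n) → V (suc n)} → Independent w → ∀ j →
                    ∃ λ g → dot g (w j) < 0# × ∀ i → dot g (w (punchIn j i)) ≈ 0#
  dual-functional {w = w} ind j with dependent (λ k i → w (punchIn j i) k)
  ... | g , (k , gk≉0) , eq with compare (dot g (w j)) 0#
  ... | tri< gw<0 _ _ = g , gw<0 , eq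
  ... | tri≈ _ gw≈0 _ = contradiction (vanishing {w = w} ind g (punchIn-elim (λ i → dot g (w i) ≈ 0#) j gw≈0 eq) k) gk≉0
  ... | tri> _ _ 0<gw = (- 1#) ⊙ g ,
    <-respˡ (sym (trans (dot-⊙ˡ (- 1#) g (w j)) (-1*x≈-x _))) (pos⇒neg 0<gw) ,
    λ i → trans (dot-⊙ˡ (- 1#) g (w (punchIn j i))) (trans (*-congˡ (eq i)) (zeroʳ _))

  -- The conic hull as an inductive closure, so that coefficients are extracted and signs compared
  -- by induction on the derivation, without coefficient vectors.
  data Cone {m d} (φ : Fin m → V d) : V d → Set (c ⊔ ℓ) where
    generator : ∀ j → Cone φ (φ j)
    origin    : Cone φ (const 0#)
    plus      : ∀ {f g} → Cone φ f → Cone φ g → Cone φ (f ⊕ g)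
    scale     : ∀ {a f} → 0# ≤ a → Cone φ f → Cone φ (a ⊙ f)
    resp      : ∀ {f g} → f ≗ g → Cone φ f → Cone φ g

  cone-mono : ∀ {m m′ d} {φ : Fin m → V d} {ψ : Fin m′ → V d} → (∀ j → Cone ψ (φ j)) →
              ∀ {f} → Cone φ f → Cone ψ f
  cone-mono φ⊆ψ (generator j) = φ⊆ψ j
  cone-mono φ⊆ψ origin        = origin
  cone-mono φ⊆ψ (plus C D)    = plus (cone-mono φ⊆ψ C) (cone-mono φ⊆ψ D)
  cone-mono φ⊆ψ (scale 0≤a C) = scale 0≤a (cone-mono φ⊆ψ C)
  cone-mono φ⊆ψ (resp f≗g C)  = resp f≗g (cone-mono φ⊆ψ C)

  cone-comb : ∀ {n m d} {φ : Fin m → V d} (t : V n) (w : Fin n → V d) →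
              (∀ i → 0# ≤ t i) → (∀ i → Cone φ (w i)) → Cone φ (comb t w)
  cone-comb {zero}  t w 0≤t C = origin
  cone-comb {suc n} t w 0≤t C = plus (scale (0≤t zero) (C zero)) (cone-comb (t ∘ suc) (w ∘ suc) (0≤t ∘ suc) (C ∘ suc))

  -- Isolates the single generator that stacking destroys.
  cone-split : ∀ {m d} {φ : Fin (suc m) → V d} j {f} → Cone φ f →
               ∃₂ λ a g → 0# ≤ a × Cone (removeAt φ j) g × f ≗ g ⊕ a ⊙ φ j
  cone-split {φ = φ} j (generator i) = punchIn-elim
    (λ i → ∃₂ λ a g → 0# ≤ a × Cone (removeAt φ j) g × φ i ≗ g ⊕ a ⊙ φ j) j
    (1# , const 0# , inj₁ 0<1 , origin , λ k → sym (trans (+-identityˡ _) (*-identityˡ _)))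
    (λ i → 0# , φ (punchIn j i) , inj₂ refl , generator i , λ k → sym (trans (+-congˡ (zeroˡ _)) (+-identityʳ _)))
    i
  cone-split j origin = 0# , const 0# , inj₂ refl , origin , λ k → sym (trans (+-identityˡ _) (zeroˡ _))
  cone-split {φ = φ} j (plus C D) =
    let a , f , 0≤a , C′ , eq  = cone-split j C
        b , g , 0≤b , D′ , eq′ = cone-split j D
    in a + b , f ⊕ g , nonneg+nonneg 0≤a 0≤b , plus C′ D′ , λ k → trans (+-cong (eq k) (eq′ k))
         (solve 5 (λ f g a b p → (f :+ a :* p) :+ (g :+ b :* p) := (f :+ g) :+ (a :+ b) :* p) refl (f k) (g k) a b (φ j k))
  cone-split {φ = φ} j (scale {b} 0≤b C) =
    let a , f , 0≤a , C′ , eq = cone-split j C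
    in b * a , b ⊙ f , nonneg*nonneg 0≤b 0≤a , scale 0≤b C′ , λ k → trans (*-congˡ (eq k))
         (solve 4 (λ f a b p → b :* (f :+ a :* p) := b :* f :+ b :* a :* p) refl (f k) a b (φ j k))
  cone-split j (resp f≗g C) =
    let a , f , 0≤a , C′ , eq = cone-split j C
    in a , f , 0≤a , C′ , λ k → trans (sym (f≗g k)) (eq k)

  -- Among the generators negative at y there is one vanishing at all zeros of f,
  -- because in a sum of nonpositive terms equal to zero all terms vanish.
  cone-separate : ∀ {m n d} {φ : Fin m → V d} {u : Fin n → V d} → (∀ j i → dot (φ j) (u i) ≤ 0#) →
    ∀ {f} → Cone φ f → (∀ i → dot f (u i) ≤ 0#) ×
    (∀ y → dot f y < 0# → ∃ λ j → dot (φ j) y < 0# × ∀ i → dot f (u i) ≈ 0# → dot (φ j) (u i) ≈ 0#)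
  cone-separate φ≤0 (generator j) = φ≤0 j , λ y neg → j , neg , λ i → λ eq → eq
  cone-separate {u = u} φ≤0 origin =
    (λ i → inj₂ (dot-0ˡ (λ _ → refl) (u i))) , λ y neg → contradiction (dot-0ˡ (λ _ → refl) y) (<⇒≉ neg)
  cone-separate {u = u} φ≤0 (plus {f} {g} C D) =
    let f≤0 , fsep = cone-separate {u = u} φ≤0 C
        g≤0 , gsep = cone-separate {u = u} φ≤0 D
        both = λ i eq → nonpos+nonpos≈0 (f≤0 i) (g≤0 i) (trans (sym (dot-⊕ˡ f g (u i))) eq)
    in (λ i → ≤-respˡ (sym (dot-⊕ˡ f g (u i))) (nonpos+nonpos (f≤0 i) (g≤0 i))) ,
       λ y neg → case sum+neg⇒neg (<-respˡ (dot-⊕ˡ f g y) neg) of λ where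
         (inj₁ fneg) → let j , jneg , jz = fsep y fneg in j , jneg , λ i eq → jz i (proj₁ (both i eq))
         (inj₂ gneg) → let j , jneg , jz = gsep y gneg in j , jneg , λ i eq → jz i (proj₂ (both i eq))
  cone-separate {φ = φ} {u} φ≤0 (scale {a} {f} 0≤a C) =
    let f≤0 , fsep = cone-separate {u = u} φ≤0 C
    in (λ i → ≤-respˡ (sym (dot-⊙ˡ a f (u i))) (nonneg*nonpos 0≤a (f≤0 i))) , λ y neg → go fsep y neg
    where
    go : (∀ y → dot f y < 0# → ∃ λ j → dot (φ j) y < 0# × ∀ i → dot f (u i) ≈ 0# → dot (φ j) (u i) ≈ 0#) →
         (∀ y → dot (a ⊙ f) y < 0# → ∃ λ j → dot (φ j) y < 0# × ∀ i → dot (a ⊙ f) (u i) ≈ 0# → dot (φ j) (u i) ≈ 0#)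
    go fsep y neg with a ≟ 0# | compare (dot f y) 0#
    ... | yes a≈0 | _ = contradiction (trans (dot-⊙ˡ a f y) (trans (*-congʳ a≈0) (zeroˡ _))) (<⇒≉ neg)
    ... | no a≉0 | tri< fneg _ _ =
      let j , jneg , jz = fsep y fneg
      in j , jneg , λ i eq → jz i (x*y≈0⇒y≈0 a≉0 (trans (sym (dot-⊙ˡ a f (u i))) eq))
    ... | no _ | tri≈ _ eq _ = contradiction (<-respˡ (dot-⊙ˡ a f y) neg) (≤⇒≯ (nonneg*nonneg 0≤a (inj₂ (sym eq))))
    ... | no _ | tri> _ _ 0<fy = contradiction (<-respˡ (dot-⊙ˡ a f y) neg) (≤⇒≯ (nonneg*nonneg 0≤a (inj₁ 0<fy)))
  cone-separate {u = u} φ≤0 (resp f≗g C) =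
    let f≤0 , fsep = cone-separate {u = u} φ≤0 C
        f≈g = λ y → dot-cong {v = y} f≗g (λ _ → refl)
    in (λ i → ≤-respˡ (f≈g (u i)) (f≤0 i)) ,
       λ y neg → let j , jneg , jz = fsep y (<-respˡ (sym (f≈g y)) neg)
                 in j , jneg , λ i eq → jz i (trans (f≈g (u i)) eq)

  -- Positivity at `y` is negativity at the opposite vector, which is admissible because
  -- `cone-separate` constrains signs only at the vertices.
  cone-separate-pos : ∀ {m n d} {φ : Fin m → V d} {u : Fin n → V d} → (∀ j i → dot (φ j) (u i) ≤ 0#) →
    ∀ {f} → Cone φ f → ∀ y → 0# < dot f y →
    ∃ λ j → 0# < dot (φ j) y × ∀ i → dot f (u i) ≈ 0# → dot (φ j) (u i) ≈ 0#
  cone-separate-pos {φ = φ} {u} φ≤0 {f} C y pos =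
    let j , neg , jz = proj₂ (cone-separate {u = u} φ≤0 C) ((- 1#) ⊙ y) (<-respˡ (sym (flip f)) (pos⇒neg pos))
    in j , <-respʳ (trans (-‿cong (flip (φ j))) (-‿involutive _)) (neg⇒pos neg) , jz
    where
    flip : ∀ g → dot g ((- 1#) ⊙ y) ≈ - dot g y
    flip g = trans (dot-⊙ʳ (- 1#) g y) (-1*x≈-x _)

-- Simplicial polytopes given by vertices and facet functionals

module Configurations {c ℓ} (ℝ : RealNumbers c ℓ) where

  open Koebe ℝ
  open RealNumbers ℝ hiding (zero)
  open OrderedField ℝ
  open LinearAlgebra ℝ
  open ≈-Reasoning

  -- Homogeneous coordinates of the vertices u i and linear functionals φ j
  -- whose zero sets are the facet planes; t lists the vertices of the facets.
  record IsConfiguration {n m} (u : Fin n → V 4) (t : Fin m → Triangle n) (φ : Fin m → V 4) : Set (c ⊔ ℓ) where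
    field
      on   : ∀ j s → dot (φ j) (u (t j s)) ≈ 0#
      off  : ∀ j i → i ∉△ t j → dot (φ j) (u i) < 0#
      span : ∀ j g → (∀ s → dot g (u (t j s)) ≈ 0#) → ∃ λ a → g ≗ a ⊙ φ j
      cone : ∀ g → (∀ i → dot g (u i) ≤ 0#) → Cone φ g

    on-∈ : ∀ j {i} → i ∈△ t j → dot (φ j) (u i) ≈ 0#
    on-∈ j (s , ≡.refl) = on j s

    nonpositive : ∀ j i → dot (φ j) (u i) ≤ 0#
    nonpositive j i with i ∈△? t j
    ... | yes i∈t = inj₂ (on-∈ j i∈t)
    ... | no  i∉t = inj₁ (off j i i∉t)

    zero⇒∈ : ∀ j i → dot (φ j) (u i) ≈ 0# → i ∈△ t j
    zero⇒∈ j i eq with i ∈△? t j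
    ... | yes i∈t = i∈t
    ... | no  i∉t = contradiction eq (<⇒≉ (off j i i∉t))

  _-⟨_⟩_ : V 4 → Carrier → V 4 → V 4
  g -⟨ a ⟩ f = g ⊕ (- a) ⊙ f

  dot-⟨⟩ : ∀ g a f y → dot (g -⟨ a ⟩ f) y ≈ dot g y - a * dot f y
  dot-⟨⟩ g a f y = begin
    dot (g ⊕ (- a) ⊙ f) y             ≈⟨ dot-⊕ˡ g ((- a) ⊙ f) y ⟩
    dot g y + dot ((- a) ⊙ f) y       ≈⟨ +-congˡ (dot-⊙ˡ (- a) f y) ⟩
    dot g y + - a * dot f y           ≈⟨ solve 3 (λ g a f → g :+ :- a :* f := g :- a :* f) refl (dot g y) a (dot f y) ⟩
    dot g y - a * dot f y             ∎

  quotient : ∀ x {y} → y ≉ 0# → Carrier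
  quotient x y≉0 = x * _ ⁻¹⟨ y≉0 ⟩

  quotient-* : ∀ x {y} (y≉0 : y ≉ 0#) → quotient x y≉0 * y ≈ x
  quotient-* x {y} y≉0 = trans (*-assoc x _ y) (trans (*-congˡ (*-inverseˡ y y≉0)) (*-identityʳ x))

  nonpos/neg : ∀ {x y} → x ≤ 0# → (y<0 : y < 0#) → 0# ≤ quotient x (<⇒≉ y<0)
  nonpos/neg {x} {y} x≤0 y<0 with compare (quotient x (<⇒≉ y<0)) 0#
  ... | tri> _ _ 0<q = inj₁ 0<q
  ... | tri≈ _ q≈0 _ = inj₂ (sym q≈0)
  ... | tri< q<0 _ _ = contradiction x≤0 λ x≤0 → ≤⇒≯ x≤0
    (<-respʳ (trans (solve 2 (λ q y → :- q :* :- y := q :* y) refl _ y) (quotient-* x (<⇒≉ y<0)))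
      (*-pos (neg⇒pos q<0) (neg⇒pos y<0)))

  nonpos/pos : ∀ {x y} → x ≤ 0# → 0# < y → (y≉0 : y ≉ 0#) → quotient x y≉0 ≤ 0#
  nonpos/pos {x} {y} x≤0 0<y y≉0 =
    ≤-respˡ (*-comm _ x) (nonneg*nonpos (inj₁ (inverse-pos 0<y y≉0)) x≤0)

  module Simplex {u : Fin 4 → V 4} {φ : Fin 4 → V 4} (independent : Independent u)
    (on : ∀ j s → dot (φ j) (u (punchIn j s)) ≈ 0#) (off : ∀ j → dot (φ j) (u j) < 0#) where

    private
      coeff : V 4 → V 4
      coeff g j = quotient (dot g (u j)) (<⇒≉ (off j))

      on≢ : ∀ {j i} → j ≢ i → dot (φ j) (u i) ≈ 0#
      on≢ {j} j≢i = ≡.subst (λ i → dot (φ j) (u i) ≈ 0#) (Finₚ.punchIn-punchOut j≢i) (on j (punchOut j≢i))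

      -- Up to scale the `φ j` are the basis dual to `u`: both sides agree on each `u i`, and
      -- `vanishing` concludes. The fields `span` and `cone` are then read off from the
      -- coefficients.
      expansion : ∀ g → g ≗ comb (coeff g) φ
      expansion g k = begin
        g k                                                   ≈⟨ solve 2 (λ x y → x := (x :- y) :+ y) refl (g k) (comb (coeff g) φ k) ⟩
        (g k - comb (coeff g) φ k) + comb (coeff g) φ k       ≈⟨ +-congʳ (trans (+-congˡ (sym (-1* _))) (vanishing {w = u} independent difference difference≈0 k)) ⟩
        0# + comb (coeff g) φ k                               ≈⟨ +-identityˡ _ ⟩
        comb (coeff g) φ k                                    ∎
        where
        -1* : ∀ x → (- 1#) * x ≈ - x
        -1* = solve 1 (λ x → (:- con ℤ.1ℤ) :* x := :- x) refl
        difference = g -⟨ 1# ⟩ comb (coeff g) φ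
        difference≈0 : ∀ i → dot difference (u i) ≈ 0#
        difference≈0 i = begin
          dot difference (u i)                                   ≈⟨ dot-⟨⟩ g 1# (comb (coeff g) φ) (u i) ⟩
          dot g (u i) - 1# * dot (comb (coeff g) φ) (u i)        ≈⟨ +-congˡ (-‿cong (*-identityˡ _)) ⟩
          dot g (u i) - dot (comb (coeff g) φ) (u i)             ≈⟨ +-congˡ (-‿cong (dot-combˡ (coeff g) φ (u i))) ⟩
          dot g (u i) - sum (λ j → coeff g j * dot (φ j) (u i))
            ≈⟨ +-congˡ (-‿cong (sum-single i λ j j≢i → trans (*-congˡ (on≢ j≢i)) (zeroʳ (coeff g j)))) ⟩
          dot g (u i) - coeff g i * dot (φ i) (u i)              ≈⟨ +-congˡ (-‿cong (quotient-* _ (<⇒≉ (off i)))) ⟩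
          dot g (u i) - dot g (u i)                              ≈⟨ -‿inverseʳ _ ⟩
          0#                                                     ∎

    isConfiguration : IsConfiguration u tetrahedron φ
    isConfiguration = record
      { on   = on
      ; off  = λ j i i∉ → ≡.subst (λ i → dot (φ j) (u i) < 0#) (only j i i∉) (off j)
      ; span = λ j g g≈0 → coeff g j , λ k → trans (expansion g k)
          (sum-single j λ i i≢j → trans (*-congʳ {φ i k} (coeff≈0 g j g≈0 i i≢j)) (zeroˡ _))
      ; cone = λ g g≤0 → resp (λ k → sym (expansion g k))
          (cone-comb (coeff g) φ (λ j → nonpos/neg (g≤0 j) (off j)) generator)
      }
      where
      only : ∀ j i → i ∉△ tetrahedron j → j ≡ i
      only j i i∉ with j Finₚ.≟ i
      ... | yes j≡i = j≡i
      ... | no  j≢i = contradiction (punchOut j≢i , Finₚ.punchIn-punchOut j≢i) i∉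
      coeff≈0 : ∀ g j → (∀ s → dot g (u (punchIn j s)) ≈ 0#) → ∀ i → i ≢ j → coeff g i ≈ 0#
      coeff≈0 g j g≈0 i i≢j = trans (*-congʳ {_ ⁻¹⟨ <⇒≉ (off i) ⟩} (≡.subst (λ i → dot g (u i) ≈ 0#)
        (Finₚ.punchIn-punchOut (i≢j ∘ ≡.sym)) (g≈0 (punchOut (i≢j ∘ ≡.sym))))) (zeroˡ _)

  -- Only signs of the new functionals are required, which lets the step serve both an arbitrary
  -- stacking point and the Descartes vertex of a packing.
  module Stacking {n m} {u : Fin (suc n) → V 4} {t : Fin (suc m) → Triangle n} {φ : Fin (suc m) → V 4}
    (T : IsTriangulation t) (C : IsConfiguration (u ∘ suc) t φ) (j : Fin (suc m))
    (beyond : 0# < dot (φ j) (u zero)) (beneath : ∀ k → dot (φ (punchIn j k)) (u zero) < 0#)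
    (ψ : Fin 3 → V 4)
    (apex : ∀ s → dot (ψ s) (u zero) ≈ 0#)
    (base : ∀ s r → r ≢ s → dot (ψ s) (u (suc (t j r))) ≈ 0#)
    (rest : ∀ s i → (∀ r → r ≢ s → t j r ≢ i) → dot (ψ s) (u (suc i)) < 0#)
    where

    open IsTriangulation T
    open IsConfiguration C

    private
      x : V 4
      x = u zero

      w : Fin 3 → V 4
      w s = u (suc (t j s))

      φx≉0 : dot (φ j) x ≉ 0#
      φx≉0 eq = <⇒≉ beyond (sym eq)

      ψw<0 : ∀ s → dot (ψ s) (w s) < 0#
      ψw<0 s = rest s (t j s) λ r r≢s → injective j r≢s

      -- Vanishing on the triangle makes `g` a multiple of `φ j`, which is positive at the apex.
      -- Hence the apex and the three corners together detect every functional.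
      x-w-vanishing : ∀ g → dot g x ≈ 0# → (∀ s → dot g (w s) ≈ 0#) → ∀ k → g k ≈ 0#
      x-w-vanishing g gx≈0 gw≈0 k =
        let a , g≗aφ = span j g gw≈0
            a≈0 = x*y≈0⇒y≈0 φx≉0 (begin
              dot (φ j) x * a       ≈⟨ *-comm _ a ⟩
              a * dot (φ j) x       ≈⟨ dot-⊙ˡ a (φ j) x ⟨
              dot (a ⊙ φ j) x       ≈⟨ dot-cong {v = x} g≗aφ (λ _ → refl) ⟨
              dot g x               ≈⟨ gx≈0 ⟩
              0#                    ∎)
        in trans (g≗aφ k) (trans (*-congʳ a≈0) (zeroˡ _))

      coeff : V 4 → V 3
      coeff g s = quotient (dot g (w s)) (<⇒≉ (ψw<0 s))

      coeffₓ : V 4 → Carrier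
      coeffₓ g = quotient (dot g x) φx≉0

      -- Each `ψ s` vanishes at the apex and at two corners, and `φ j` at all three corners; up to
      -- scale these four functionals are dual to the corners and the apex.
      expansion : ∀ g → g ≗ comb (coeff g) ψ ⊕ coeffₓ g ⊙ φ j
      expansion g k = begin
        g k                   ≈⟨ solve 2 (λ x y → x := (x :+ :- con ℤ.1ℤ :* y) :+ y) refl (g k) (f k) ⟩
        difference k + f k    ≈⟨ +-congʳ (x-w-vanishing difference at-x at-w k) ⟩
        0# + f k              ≈⟨ +-identityˡ _ ⟩
        f k                   ∎
        where
        f = comb (coeff g) ψ ⊕ coeffₓ g ⊙ φ j
        difference = g -⟨ 1# ⟩ f
        f-value : ∀ y → dot f y ≈ sum (λ s → coeff g s * dot (ψ s) y) + coeffₓ g * dot (φ j) y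
        f-value y = trans (dot-⊕ˡ (comb (coeff g) ψ) (coeffₓ g ⊙ φ j) y) (+-cong (dot-combˡ (coeff g) ψ y) (dot-⊙ˡ (coeffₓ g) (φ j) y))
        difference≈0 : ∀ y → dot f y ≈ dot g y → dot difference y ≈ 0#
        difference≈0 y eq = trans (dot-⟨⟩ g 1# f y) (trans (+-congˡ (-‿cong (trans (*-identityˡ _) eq))) (-‿inverseʳ _))
        at-x : dot difference x ≈ 0#
        at-x = difference≈0 x (begin
          dot f x                                                                     ≈⟨ f-value x ⟩
          sum (λ s → coeff g s * dot (ψ s) x) + coeffₓ g * dot (φ j) x                ≈⟨ +-cong (sum-zero λ s → trans (*-congˡ (apex s)) (zeroʳ (coeff g s))) (quotient-* _ φx≉0) ⟩
          0# + dot g x                                                                ≈⟨ +-identityˡ _ ⟩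
          dot g x                                                                     ∎)
        at-w : ∀ s → dot difference (w s) ≈ 0#
        at-w s = difference≈0 (w s) (begin
          dot f (w s)                                                                   ≈⟨ f-value (w s) ⟩
          sum (λ r → coeff g r * dot (ψ r) (w s)) + coeffₓ g * dot (φ j) (w s)
            ≈⟨ +-cong (sum-single s λ r r≢s → trans (*-congˡ (base r s (r≢s ∘ ≡.sym))) (zeroʳ (coeff g r)))
                 (trans (*-congˡ (on j s)) (zeroʳ _)) ⟩
          coeff g s * dot (ψ s) (w s) + 0#                                              ≈⟨ +-identityʳ _ ⟩
          coeff g s * dot (ψ s) (w s)                                                   ≈⟨ quotient-* _ (<⇒≉ (ψw<0 s)) ⟩
          dot g (w s)                                                                   ∎)

      φ′ : Fin (3 ℕ.+ m) → V 4
      φ′ = ψ ++ removeAt φ j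

      -- If f = A + a φ j with a > 0 and A in the cone of the other facets, and
      -- f = B + b φ j with b ≤ 0 and B in the cone of the new facets, then
      -- (a - b) f = a B - b A.
      stacked-cone : ∀ f → (∀ i → dot f (u i) ≤ 0#) → Cone φ′ f
      stacked-cone f f≤0 with cone-split j (cone f (f≤0 ∘ suc))
      ... | a , A , 0≤a , coneA , f≗A with a ≟ 0#
      ... | yes a≈0 = resp (λ k → sym (trans (f≗A k) (trans (+-congˡ (trans (*-congʳ a≈0) (zeroˡ _))) (+-identityʳ _))))
                        (cone-mono old coneA)
        where
        old : ∀ k → Cone φ′ (removeAt φ j k)
        old k = generator (3 ↑ʳ k)
      ... | no a≉0 = resp eq (scale (inj₁ (inverse-pos 0<d d≉0)) (plus (scale 0≤a coneB) (scale (nonpos⇒nonneg b≤0) (cone-mono old coneA))))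
        where
        old : ∀ k → Cone φ′ (removeAt φ j k)
        old k = generator (3 ↑ʳ k)
        new : ∀ s → Cone φ′ (ψ s)
        new s = let i , ψs≡ = ++-existsˡ ψ (removeAt φ j) (ψ s ≡_) s ≡.refl
                in ≡.subst (Cone φ′) (≡.sym ψs≡) (generator i)
        b = coeffₓ f
        B = comb (coeff f) ψ
        b≤0 : b ≤ 0#
        b≤0 = nonpos/pos (f≤0 zero) beyond φx≉0
        coneB : Cone φ′ B
        coneB = cone-comb (coeff f) ψ (λ s → nonpos/neg (f≤0 (suc (t j s))) (ψw<0 s)) new
        d = a - b
        0<d : 0# < d
        0<d = pos+nonneg (≤∧≉⇒< 0≤a (a≉0 ∘ sym)) (nonpos⇒nonneg b≤0)
        d≉0 : d ≉ 0#
        d≉0 = <⇒≉ 0<d ∘ sym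
        eq : d ⁻¹⟨ d≉0 ⟩ ⊙ (a ⊙ B ⊕ (- b) ⊙ A) ≗ f
        eq k = begin
          d ⁻¹⟨ d≉0 ⟩ * (a * B k + - b * A k)
            ≈⟨ solve 6 (λ i a b A B p → i :* (a :* B :+ :- b :* A) := i :* (a :* (B :+ b :* p) :- b :* (A :+ a :* p))) refl
                 (d ⁻¹⟨ d≉0 ⟩) a b (A k) (B k) (φ j k) ⟩
          d ⁻¹⟨ d≉0 ⟩ * (a * (B k + b * φ j k) - b * (A k + a * φ j k))
            ≈⟨ *-congˡ (+-cong (*-congˡ (expansion f k)) (-‿cong (*-congˡ (f≗A k)))) ⟨
          d ⁻¹⟨ d≉0 ⟩ * (a * f k - b * f k)
            ≈⟨ solve 4 (λ i a b f → i :* (a :* f :- b :* f) := i :* (a :- b) :* f) refl (d ⁻¹⟨ d≉0 ⟩) a b (f k) ⟩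
          d ⁻¹⟨ d≉0 ⟩ * d * f k
            ≈⟨ *-congʳ (*-inverseˡ d d≉0) ⟩
          1# * f k
            ≈⟨ *-identityˡ _ ⟩
          f k ∎

    isConfiguration : IsConfiguration u (stack△ t j) (ψ ++ removeAt φ j)
    isConfiguration = record
      { on   = Pointwiseₚ.++⁺ (λ τ f → ∀ s → dot f (u (τ s)) ≈ 0#) 
                 {xs = Stack.new t j} {ys = ψ} {xs′ = Stack.old t j} {ys′ = removeAt φ j}
                 (λ s → cone△-elim (t j) s (λ i → dot (ψ s) (u i) ≈ 0#) (apex s) (base s))
                 (λ k → on (punchIn j k))
      ; off  = Pointwiseₚ.++⁺ (λ τ f → ∀ i → i ∉△ τ → dot f (u i) < 0#) 
                 {xs = Stack.new t j} {ys = ψ} {xs′ = Stack.old t j} {ys′ = removeAt φ j}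
                 (λ { s zero ∉ → contradiction (apex∈cone△ (t j) s) ∉
                    ; s (suc i) ∉ → rest s i λ { r r≢s ≡.refl → ∉ (base∈cone△ (t j) s r≢s) } })
                 (λ { k zero ∉ → beneath k
                    ; k (suc i) ∉ → off (punchIn j k) i (∉ ∘ lift∈ (t (punchIn j k))) })
      ; span = Pointwiseₚ.++⁺ (λ τ f → ∀ g → (∀ s → dot g (u (τ s)) ≈ 0#) → ∃ λ a → g ≗ a ⊙ f) 
                 {xs = Stack.new t j} {ys = ψ} {xs′ = Stack.old t j} {ys′ = removeAt φ j}
                 (λ s g g≈0 → coeff g s , λ k → new-span s g g≈0 k)
                 (λ k → span (punchIn j k))
      ; cone = stacked-cone
      }
      where
      new-span : ∀ s g → (∀ r → dot g (u (cone△ (t j) s r)) ≈ 0#) → g ≗ coeff g s ⊙ ψ s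
      new-span s g g≈0 k = begin
        g k                                                ≈⟨ expansion g k ⟩
        comb (coeff g) ψ k + coeffₓ g * φ j k              ≈⟨ +-cong
             (sum-single s λ r r≢s → trans (*-congʳ {ψ r k} (trans (*-congʳ {_ ⁻¹⟨ <⇒≉ (ψw<0 r) ⟩} (at-w r r≢s)) (zeroˡ _))) (zeroˡ _))
             (trans (*-congʳ (trans (*-congʳ at-x) (zeroˡ _))) (zeroˡ _)) ⟩
        coeff g s * ψ s k + 0#                             ≈⟨ +-identityʳ _ ⟩
        coeff g s * ψ s k                                  ∎
        where
        at-x : dot g x ≈ 0#
        at-x = ≡.subst (λ i → dot g (u i) ≈ 0#) (cone△-apex (t j) s) (g≈0 s)
        at-w : ∀ r → r ≢ s → dot g (w r) ≈ 0#
        at-w r r≢s = ≡.subst (λ i → dot g (u i) ≈ 0#) (cone△-base (t j) s r≢s) (g≈0 r)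

-- Face lattices

module Faces {c ℓ} (ℝ : RealNumbers c ℓ) where

  open Koebe ℝ
  open RealNumbers ℝ hiding (zero)
  open OrderedField ℝ
  open LinearAlgebra ℝ
  open Configurations ℝ
  open ≈-Reasoning

  dual-independent : ∀ {n d} {w g : Fin n → V d} → (∀ s → dot (g s) (w s) ≉ 0#) →
                     (∀ s r → r ≢ s → dot (g s) (w r) ≈ 0#) → Independent w
  dual-independent {w = w} {g} diag off t t≈0 s = x*y≈0⇒y≈0 (diag s) (begin
    dot (g s) (w s) * t s                ≈⟨ *-comm _ (t s) ⟩
    t s * dot (g s) (w s)                ≈⟨ sum-single s (λ r r≢s → trans (*-congˡ (off s r r≢s)) (zeroʳ (t r))) ⟨
    sum (λ r → t r * dot (g s) (w r))    ≈⟨ dot-combʳ (g s) t w ⟨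
    dot (g s) (comb t w)                 ≈⟨ dot-comm (g s) (comb t w) ⟩
    dot (comb t w) (g s)                 ≈⟨ dot-0ˡ t≈0 (g s) ⟩
    0#                                   ∎)

  -- The coefficient rows are `suc d` vectors of length `d`; a dependency among them passes to the
  -- `y i`. This bounds the number of independent points of a face.
  comb-dependent : ∀ {d e} {y : Fin (suc d) → V e} {w : Fin d → V e} →
                   (∀ i → ∃ λ t → y i ≗ comb t w) → ¬ Independent y
  comb-dependent {y = y} {w} y∈w ind =
    let M = λ i → proj₁ (y∈w i)
        t , (i , ti≉0) , tM≈0 = dependent M
    in ti≉0 (ind t (λ k → begin
         sum (λ i → t i * y i k)                       ≈⟨ sum-cong-≋ (λ i → *-congˡ {t i} (proj₂ (y∈w i) k)) ⟩
         dot t (λ i → dot (M i) (λ s → w s k))         ≈⟨ sum-cong-≋ (λ i → *-congˡ {t i} (dot-comm (M i) (λ s → w s k))) ⟩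
         dot t (λ i → dot (λ s → w s k) (M i))         ≈⟨ dot-combʳ (λ s → w s k) t M ⟨
         dot (λ s → w s k) (comb t M)                  ≈⟨ dot-comm (λ s → w s k) (comb t M) ⟩
         dot (comb t M) (λ s → w s k)                  ≈⟨ dot-0ˡ tM≈0 (λ s → w s k) ⟩
         0#                                            ∎) i)

  δ : ∀ {d} → Fin d → V d
  δ k = updateAt (const 0#) k (const 1#)

  dot-δ : ∀ {d} k (y : V d) → dot (δ k) y ≈ y k
  dot-δ k y = begin
    dot (δ k) y      ≈⟨ sum-single k (λ j j≢k → trans (*-congʳ (reflexive (updateAt-minimal j k (const 0#) j≢k))) (zeroˡ (y j))) ⟩
    δ k k * y k      ≈⟨ *-congʳ (reflexive (updateAt-updates k (const 0#))) ⟩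
    1# * y k         ≈⟨ *-identityˡ (y k) ⟩
    y k              ∎

  δ-nonneg : ∀ {d} (i j : Fin d) → 0# ≤ δ i j
  δ-nonneg i j with j Finₚ.≟ i
  ... | yes ≡.refl = inj₁ (<-respʳ (sym (reflexive (updateAt-updates j (const 0#)))) 0<1)
  ... | no  j≢i    = inj₂ (sym (reflexive (updateAt-minimal j i (const 0#) j≢i)))

  hom : Point → V 4
  hom x = 1# ∷ x

  dot-hom : ∀ f x → dot f (hom x) ≈ f zero + tail f ∙ x
  dot-hom f x = +-congʳ (*-identityʳ (f zero))

  hom-comb : ∀ {n} {t : V n} {p : Vector Point n} {x} → sum t ≈ 1# → x ≋ linearCombination t p →
             hom x ≗ comb t (hom ∘ p)
  hom-comb {t = t} ∑t≈1 x≋ zero    = sym (trans (sum-cong-≋ λ i → *-identityʳ (t i)) ∑t≈1)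
  hom-comb         ∑t≈1 x≋ (suc k) = x≋ k

  affineHull : ∀ {n} {t : V n} {p : Vector Point n} {x} → hom x ≗ comb t (hom ∘ p) → AffineHull p x
  affineHull {t = t} eq = t , trans (sum-cong-≋ λ i → sym (*-identityʳ (t i))) (sym (eq zero)) , eq ∘ suc

  affinelyIndependent⁺ : ∀ {n} {p : Vector Point n} → Independent (hom ∘ p) → AffinelyIndependent p
  affinelyIndependent⁺ ind t ∑t≈0 t≈0 = ind t λ where
    zero    → trans (sum-cong-≋ λ i → *-identityʳ (t i)) ∑t≈0
    (suc k) → t≈0 k

  affinelyIndependent⁻ : ∀ {n} {p : Vector Point n} → AffinelyIndependent p → Independent (hom ∘ p)
  affinelyIndependent⁻ ind t t≈0 = ind t (trans (sum-cong-≋ λ i → sym (*-identityʳ (t i))) (t≈0 zero)) (t≈0 ∘ suc)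

  convexHull-vertex : ∀ {n} (v : Vector Point n) i → ConvexHull v (v i)
  convexHull-vertex v i = δ i , δ-nonneg i , trans (sum-cong-≋ λ j → sym (*-identityʳ (δ i j))) (dot-δ i (const 1#)) ,
                          λ k → sym (dot-δ i (λ j → v j k))

  convexHull-value : ∀ {n} (v : Vector Point n) {x} ((t , _) : ConvexHull v x) f →
                     dot f (hom x) ≈ sum (λ i → t i * dot f (hom (v i)))
  convexHull-value v {x} (t , _ , ∑t≈1 , x≋) f =
    trans (dot-cong {u = f} (λ _ → refl) (hom-comb {p = v} ∑t≈1 x≋)) (dot-combʳ f t (hom ∘ v))

  functional : ∀ {P} → Face P → V 4
  functional F = (- offset F) ∷ normal F

  functional-value : ∀ {P} (F : Face P) x → dot (functional F) (hom x) ≈ normal F ∙ x - offset F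
  functional-value F x = trans (dot-hom (functional F) x) (+-comm _ _)

  x≈y⇒x-y≈0 : ∀ {x y} → x ≈ y → x - y ≈ 0#
  x≈y⇒x-y≈0 x≈y = trans (+-congʳ x≈y) (-‿inverseʳ _)

  x-y≈0⇒x≈y : ∀ {x y} → x - y ≈ 0# → x ≈ y
  x-y≈0⇒x≈y {x} {y} eq = begin
    x             ≈⟨ solve 2 (λ x y → x := (x :- y) :+ y) refl x y ⟩
    x - y + y     ≈⟨ +-congʳ eq ⟩
    0# + y        ≈⟨ +-identityˡ y ⟩
    y             ∎

  x≤y⇒x-y≤0 : ∀ {x y} → x ≤ y → x - y ≤ 0#
  x≤y⇒x-y≤0 {x} {y} x≤y = ≤-respʳ (-‿inverseʳ y) (+-mono-≤ x≤y (inj₂ refl))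

  x-y≤0⇒x≤y : ∀ {x y} → x - y ≤ 0# → x ≤ y
  x-y≤0⇒x≤y {x} {y} le = ≤-respˡ (solve 2 (λ x y → (x :- y) :+ y := x) refl x y)
    (≤-respʳ (+-identityˡ y) (+-mono-≤ le (inj₂ refl)))

  -- `v` is kept apart from the generators of `P`, since `IsStacked` equates only the point sets.
  module Realization (P : Polytope) {n m} (v : Vector Point n) (P≐v : ⟦ P ⟧ ≐ ConvexHull v)
    {t : Fin m → Triangle n} (T : IsTriangulation t)
    {φ : Fin m → V 4} (C : IsConfiguration (hom ∘ v) t φ) where

    open IsTriangulation T public
    open IsConfiguration C public

    u : Fin n → V 4
    u = hom ∘ v

    vertex∈P : ∀ i → ⟦ P ⟧ (v i)
    vertex∈P i = proj₂ P≐v (convexHull-vertex v i)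

    infix 4 _∋_ _∋?_ _⊆△_ _⊆△?_

    -- Incidence is an equation between field elements and hence decidable; faces are compared
    -- through it alone.
    _∋_ : Face P → Fin n → Set ℓ
    F ∋ i = dot (functional F) (u i) ≈ 0#

    _∋?_ : ∀ F i → Dec (F ∋ i)
    F ∋? i = dot (functional F) (u i) ≟ 0#

    face-nonpositive : ∀ (F : Face P) i → dot (functional F) (u i) ≤ 0#
    face-nonpositive F i = ≤-respˡ (sym (functional-value F (v i))) (x≤y⇒x-y≤0 (valid F (v i) (vertex∈P i)))

    ∋⇒∈ : ∀ {F i} → F ∋ i → points F (v i)
    ∋⇒∈ {F} {i} F∋i = vertex∈P i , x-y≈0⇒x≈y (trans (sym (functional-value F (v i))) F∋i)

    point-value : ∀ {F : Face P} {x} → points F x → dot (functional F) (hom x) ≈ 0#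
    point-value {F} {x} (_ , eq) = trans (functional-value F x) (x≈y⇒x-y≈0 eq)

    ∈⇒∋ : ∀ {F i} → points F (v i) → F ∋ i
    ∈⇒∋ {F} = point-value {F}

    -- The functional of `F` at `x` is a sum of nonpositive terms with value zero, so every term
    -- vanishes: a vertex of nonzero weight lies on `F`.
    support : ∀ {F : Face P} {x} (x∈F : points F x) i → proj₁ (proj₁ P≐v (proj₁ x∈F)) i ≉ 0# → F ∋ i
    support {F} {x} x∈F i ti≉0 =
      let x∈v@(t , 0≤t , _) = proj₁ P≐v (proj₁ x∈F)
      in x*y≈0⇒y≈0 ti≉0 (sum-nonpos≈0 (λ i → nonneg*nonpos (0≤t i) (face-nonpositive F i))
           (trans (sym (convexHull-value v x∈v (functional F))) (point-value {F} x∈F)) i)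

    -- Only vertices in the support of `x` contribute, and all of these lie on `F`. Applied to the
    -- functional of another face, this reduces inclusion of faces to inclusion of vertex sets.
    vanishes-on : ∀ {F : Face P} g → (∀ i → F ∋ i → dot g (u i) ≈ 0#) → ∀ {x} → points F x → dot g (hom x) ≈ 0#
    vanishes-on {F} g g≈0 x∈F =
      let x∈v@(t , _) = proj₁ P≐v (proj₁ x∈F)
      in trans (convexHull-value v x∈v g) (sum-zero λ i → term i (support {F} x∈F i))
      where
      term : ∀ i {a} → (a ≉ 0# → F ∋ i) → a * dot g (u i) ≈ 0#
      term i {a} h with a ≟ 0#
      ... | yes a≈0 = trans (*-congʳ a≈0) (zeroˡ _)
      ... | no  a≉0 = trans (*-congˡ (g≈0 i (h a≉0))) (zeroʳ a)

    ≤ᶠ⇒∋ : ∀ {F G : Face P} → F ≤ᶠ G → ∀ i → F ∋ i → G ∋ i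
    ≤ᶠ⇒∋ {F} {G} F≤G i F∋i = ∈⇒∋ {G} (F≤G (v i) (∋⇒∈ {F} F∋i))

    ∋⇒≤ᶠ : ∀ {F G : Face P} → (∀ i → F ∋ i → G ∋ i) → F ≤ᶠ G
    ∋⇒≤ᶠ {F} {G} F⊆G x x∈F = proj₁ x∈F ,
      x-y≈0⇒x≈y (trans (sym (functional-value G x)) (vanishes-on {F} (functional G) F⊆G x∈F))

    toFace : ∀ f → (∀ i → dot f (u i) ≤ 0#) → Face P
    toFace f f≤0 = record
      { normal = tail f
      ; offset = - f zero
      ; valid  = λ x x∈P → let x∈v@(t , 0≤t , _) = proj₁ P≐v x∈P in
          x-y≤0⇒x≤y (≤-respˡ (trans (dot-hom f x) (solve 2 (λ a b → a :+ b := b :- :- a) refl (f zero) (tail f ∙ x)))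
            (≤-respˡ (sym (convexHull-value v x∈v f)) (sum-nonpos λ i → nonneg*nonpos (0≤t i) (f≤0 i))))
      }

    toFace-value : ∀ f f≤0 y → dot (functional (toFace f f≤0)) y ≈ dot f y
    toFace-value f f≤0 y = +-congʳ (*-congʳ (-‿involutive (f zero)))

    _⊆△_ : Face P → Triangle n → Set ℓ
    F ⊆△ τ = ∀ i → F ∋ i → i ∈△ τ

    _⊆△?_ : ∀ F τ → Dec (F ⊆△ τ)
    F ⊆△? τ = Finₚ.all? λ i → (F ∋? i) →-dec (i ∈△? τ)

    separate : ∀ (F : Face P) y → dot (functional F) y < 0# → ∃ λ j → dot (φ j) y < 0# × F ⊆△ t j
    separate F y neg =
      let j , φy<0 , zeros = proj₂ (cone-separate {u = u} nonpositive (cone (functional F) (face-nonpositive F))) y neg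
      in j , φy<0 , λ i F∋i → zero⇒∈ j i (zeros i F∋i)

    separate-pos : ∀ (F : Face P) y → 0# < dot (functional F) y → ∃ λ j → 0# < dot (φ j) y × F ⊆△ t j
    separate-pos F y pos =
      let j , φy>0 , zeros = cone-separate-pos {u = u} nonpositive (cone (functional F) (face-nonpositive F)) y pos
      in j , φy>0 , λ i F∋i → zero⇒∈ j i (zeros i F∋i)

    -- A face has no vertices beyond those common to the facets containing it: where `F` is
    -- negative, `separate` finds a facet through `F` that misses the vertex.
    closed : ∀ (F : Face P) i → (∀ j → F ⊆△ t j → i ∈△ t j) → F ∋ i
    closed F i i∈ with face-nonpositive F i
    ... | inj₂ F∋i = F∋i
    ... | inj₁ neg = let j , φ<0 , F⊆j = separate F (u i) neg in contradiction (on-∈ j (i∈ j F⊆j)) (<⇒≉ φ<0)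

    facet : Fin m → Face P
    facet j = toFace (φ j) (nonpositive j)

    facet∋⇒∈ : ∀ j i → facet j ∋ i → i ∈△ t j
    facet∋⇒∈ j i eq = zero⇒∈ j i (trans (sym (toFace-value (φ j) (nonpositive j) (u i))) eq)

    ∈⇒facet∋ : ∀ j i → i ∈△ t j → facet j ∋ i
    ∈⇒facet∋ j i i∈ = trans (toFace-value (φ j) (nonpositive j) (u i)) (on-∈ j i∈)

    -- The functionals of the three neighbouring facets. Each vanishes at two corners and not at the
    -- third, so up to scale they are dual to the corners.
    opposite : Fin m → Fin 3 → V 4
    opposite j s = φ (proj₁ (neighbour j s))

    opposite-diag : ∀ j s → dot (opposite j s) (u (t j s)) ≉ 0#
    opposite-diag j s = <⇒≉ (off _ _ (proj₁ (proj₂ (neighbour j s))))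

    opposite-off : ∀ j s r → r ≢ s → dot (opposite j s) (u (t j r)) ≈ 0#
    opposite-off j s r r≢s = on-∈ _ (proj₂ (proj₂ (neighbour j s)) r r≢s)

    triangle-independent : ∀ j → Independent (u ∘ t j)
    triangle-independent j = dual-independent {w = u ∘ t j} {g = opposite j} (opposite-diag j) (opposite-off j)

    -- Subtracting from a functional `f` its interpolant in the `g s` leaves one that vanishes on
    -- the vertices of `F`, hence at `x`. So `f` at `x` is a combination of its values at the
    -- `u (r s)` with weights independent of `f`, and the coordinate functionals `δ k` turn this
    -- into an identity of vectors.
    interpolate : ∀ {d} (r : Fin d → Fin n) (g : Fin d → V 4) (diag : ∀ s → dot (g s) (u (r s)) ≉ 0#) →
      (∀ s q → q ≢ s → dot (g s) (u (r q)) ≈ 0#) →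
      ∀ {F : Face P} → (∀ i → F ∋ i → ∃ λ s → r s ≡ i) → ∀ {x} → points F x → ∃ λ a → hom x ≗ comb a (u ∘ r)
    interpolate r g diag offdiag {F} F⊆r {x} x∈F = a , λ k → begin
      hom x k                                        ≈⟨ dot-δ k (hom x) ⟨
      dot (δ k) (hom x)                              ≈⟨ interpolated (δ k) ⟩
      sum (λ s → a s * dot (δ k) (u (r s)))          ≈⟨ sum-cong-≋ (λ s → *-congˡ {a s} (dot-δ k (u (r s)))) ⟩
      comb a (u ∘ r) k                               ∎
      where
      a : V _
      a s = quotient (dot (g s) (hom x)) (diag s)
      module _ (f : V 4) where
        b : V _
        b s = quotient (dot f (u (r s))) (diag s)
        residue : V 4
        residue = f -⟨ 1# ⟩ comb b g
        residue-value : ∀ y → dot residue y ≈ dot f y - sum (λ s → b s * dot (g s) y)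
        residue-value y = trans (dot-⟨⟩ f 1# (comb b g) y) (+-congˡ (-‿cong (trans (*-identityˡ _) (dot-combˡ b g y))))
        residue≈0 : ∀ i → F ∋ i → dot residue (u i) ≈ 0#
        residue≈0 i F∋i with F⊆r i F∋i
        ... | s , ≡.refl = trans (residue-value (u (r s))) (x≈y⇒x-y≈0 (sym (begin
          sum (λ q → b q * dot (g q) (u (r s)))    ≈⟨ sum-single s (λ q q≢s → trans (*-congˡ (offdiag q s (q≢s ∘ ≡.sym))) (zeroʳ (b q))) ⟩
          b s * dot (g s) (u (r s))                ≈⟨ quotient-* _ (diag s) ⟩
          dot f (u (r s))                          ∎)))
        interpolated : dot f (hom x) ≈ sum (λ s → a s * dot f (u (r s)))
        interpolated = begin
          dot f (hom x)                            ≈⟨ x-y≈0⇒x≈y (trans (sym (residue-value (hom x))) (vanishes-on {F} residue residue≈0 x∈F)) ⟩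
          sum (λ s → b s * dot (g s) (hom x))      ≈⟨ sum-cong-≋ (λ s → solve 3 (λ f i g → f :* i :* g := g :* i :* f) refl (dot f (u (r s))) _ (dot (g s) (hom x))) ⟩
          sum (λ s → a s * dot f (u (r s)))        ∎

    facet-isFacet : ∀ j → IsFacet (facet j)
    facet-isFacet j = v ∘ t j , (λ s → ∋⇒∈ {facet j} (∈⇒facet∋ j (t j s) (s , ≡.refl))) ,
      affinelyIndependent⁺ {p = v ∘ t j} (triangle-independent j) ,
      λ x x∈ → let a , eq = interpolate (t j) (opposite j) (opposite-diag j) (opposite-off j) {facet j} (facet∋⇒∈ j) x∈
               in affineHull {t = a} {p = v ∘ t j} {x} eq

    -- `Beyond` refers to one inequality defining `F`, so the triangle has to be recovered. That
    -- inequality is a nonnegative combination of facet functionals, one of which must be positive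
    -- at `x`, and its triangle contains the vertices of `F`. No other facet can equal `F`, since
    -- its triangle is not contained in this one.
    beyond⇒sign : ∀ (F : Face P) x → Beyond F x →
      ∃ λ j → 0# < dot (φ j) (hom x) × ∀ k → k ≢ j → dot (φ k) (hom x) < 0#
    beyond⇒sign F x B =
      let j , pos , F⊆j = separate-pos F (hom x) (<-respʳ (sym (functional-value F x))
                            (<-respˡ (-‿inverseʳ (offset F)) (+-monoˡ-< (- offset F) beyond)))
      in j , pos , λ k k≢j →
        let k≉F = λ { (k≤F , _) → let s , tks∉tj = distinct k j k≢j in
                      tks∉tj (F⊆j (t k s) (≤ᶠ⇒∋ {facet k} {F} k≤F (t k s) (∈⇒facet∋ k (t k s) (s , ≡.refl)))) }
        in <-respˡ (toFace-value (φ k) (nonpositive k) (hom x)) (<-respˡ (sym (functional-value (facet k) x))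
             (<-respʳ (-‿inverseʳ _) (+-monoˡ-< (- offset (facet k)) (beneath (facet k) (facet-isFacet k) k≉F))))
      where open Beyond B

    module Edge {E : Face P} (E-isEdge : IsEdge E) where

      private
        p = proj₁ E-isEdge
        p∈E = proj₁ (proj₂ E-isEdge)
        p-independent = proj₁ (proj₂ (proj₂ E-isEdge))
        E⊆p = proj₂ (proj₂ (proj₂ E-isEdge))

      -- Three independent corners do not fit into the affine hull of two points.
      triangle⊈ : ∀ j → ¬ (∀ s → E ∋ t j s)
      triangle⊈ j all = comb-dependent {y = u ∘ t j} {w = hom ∘ p} in-hull (triangle-independent j)
        where
        in-hull : ∀ s → ∃ λ a → u (t j s) ≗ comb a (hom ∘ p)
        in-hull s =
          let a , ∑a≈1 , eq = E⊆p (v (t j s)) (∋⇒∈ {E} (all s))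
          in a , hom-comb {t = a} {p = p} {x = v (t j s)} ∑a≈1 eq

      missing : ∀ j → ∃ λ s → ¬ E ∋ t j s
      missing j = Finₚ.¬∀⟶∃¬ 3 (λ s → E ∋ t j s) (λ s → E ∋? t j s) (triangle⊈ j)

      singleton⊉ : ∀ j r → ¬ (∀ i → E ∋ i → t j r ≡ i)
      singleton⊉ j r single = comb-dependent {y = hom ∘ p} {w = w} in-span (affinelyIndependent⁻ {p = p} p-independent)
        where
        w : Fin 1 → V 4
        w _ = u (t j r)
        in-span : ∀ i → ∃ λ a → hom (p i) ≗ comb a w
        in-span i = interpolate {1} (λ _ → t j r) (λ _ → opposite j r) (λ _ → opposite-diag j r)
          (λ { zero zero 0≢0 → contradiction ≡.refl 0≢0 ; zero (suc ()) ; (suc ()) }) {E} (λ i E∋i → zero , single i E∋i) {p i} (p∈E i)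

      -- An arbitrary facet serves to show that `E` is not the whole polytope: at a corner that `E`
      -- misses its functional is negative, which is what `separate` needs.
      containing : Fin m → ∃ λ j → E ⊆△ t j
      containing j₀ =
        let s , ∌s      = missing j₀
            j , _ , E⊆j = separate E (u (t j₀ s)) (≤∧≉⇒< (face-nonpositive E (t j₀ s)) ∌s)
        in j , E⊆j

      module _ (j : Fin m) (s : Fin 3) (E⊆j : E ⊆△ t j) (∌s : ¬ E ∋ t j s) where

        two-vertices⁻ : ∀ i → E ∋ i → ∃ λ q → t j (punchIn s q) ≡ i
        two-vertices⁻ i E∋i with E⊆j i E∋i
        ... | r , ≡.refl with s Finₚ.≟ r
        ... | yes ≡.refl = contradiction E∋i ∌s
        ... | no  s≢r    = punchOut s≢r , ≡.cong (t j) (Finₚ.punchIn-punchOut s≢r)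

        -- If this corner were missing, at most the other end of the edge would remain, and a single
        -- vertex cannot carry two independent points.
        two-vertices⁺ : ∀ q → E ∋ t j (punchIn s q)
        two-vertices⁺ q with E ∋? t j (punchIn s q)
        ... | yes ∋q = ∋q
        ... | no  ∌q = contradiction single (singleton⊉ j (punchIn s (punchIn q zero)))
          where
          unique : ∀ (i : Fin 1) → zero ≡ i
          unique zero = ≡.refl
          single : ∀ i → E ∋ i → t j (punchIn s (punchIn q zero)) ≡ i
          single i E∋i with two-vertices⁻ i E∋i
          ... | q′ , ≡.refl with q Finₚ.≟ q′
          ... | yes ≡.refl = contradiction E∋i ∌q
          ... | no  q≢q′   = ≡.cong (t j ∘ punchIn s)
            (≡.trans (≡.cong (punchIn q) (unique (punchOut q≢q′))) (Finₚ.punchIn-punchOut q≢q′))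

      edge-vertices : Fin m → ∃₂ λ j s → (∀ q → E ∋ t j (punchIn s q)) × (∀ i → E ∋ i → ∃ λ q → t j (punchIn s q) ≡ i)
      edge-vertices j₀ =
        let j , E⊆j = containing j₀
            s , ∌s  = missing j
        in j , s , two-vertices⁺ j s E⊆j ∌s , two-vertices⁻ j s E⊆j ∌s

    -- The weights of `x` sum to one, so some weight is nonzero; by `support` its vertex lies on the
    -- face that consists of `x` alone.
    vertex-index : ∀ {x} → IsVertex P x → ∃ λ i → v i ≋ x
    vertex-index {x} (F , F⊆x , x⊆F) =
      let x∈F = x⊆F {x} (λ _ → refl)
          a , _ , ∑a≈1 , _ = proj₁ P≐v (proj₁ x∈F)
          i , ai≉0 = Finₚ.¬∀⟶∃¬ n (λ i → a i ≈ 0#) (λ i → a i ≟ 0#) (λ a≈0 → 1≉0 (trans (sym ∑a≈1) (sum-zero a≈0)))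
      in i , F⊆x (∋⇒∈ {F} (support {F} x∈F i ai≉0))

  -- The witness is the sum of the selected functionals: at a vertex all terms are nonpositive, so
  -- the sum vanishes exactly where each of them does. The empty selection yields the zero
  -- functional, whose face is the whole polytope.
  meet : ∀ {n m p} (u : Fin n → V 4) (φ : Fin m → V 4) → (∀ j i → dot (φ j) (u i) ≤ 0#) →
         {D : Fin m → Set p} → (∀ j → Dec (D j)) →
         ∃ λ f → (∀ i → dot f (u i) ≤ 0#) × (∀ i → dot f (u i) ≈ 0# → ∀ j → D j → dot (φ j) (u i) ≈ 0#)
               × (∀ i → (∀ j → D j → dot (φ j) (u i) ≈ 0#) → dot f (u i) ≈ 0#)
  meet {m = zero} u φ φ≤0 D? = const 0# , (λ i → inj₂ (f≈0 i)) , (λ _ _ ()) , λ i _ → f≈0 i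
    where
    f≈0 : ∀ i → dot (const 0#) (u i) ≈ 0#
    f≈0 i = dot-0ˡ (λ _ → refl) (u i)
  meet {m = suc m} u φ φ≤0 D? with meet u (φ ∘ suc) (φ≤0 ∘ suc) (D? ∘ suc) | D? zero
  ... | f , f≤0 , f⇒ , f⇐ | no ¬D =
    f , f≤0 , (λ { i eq zero D → contradiction D ¬D ; i eq (suc j) → f⇒ i eq j }) , λ i h → f⇐ i (h ∘ suc)
  ... | f , f≤0 , f⇒ , f⇐ | yes D =
    φ zero ⊕ f , (λ i → ≤-respˡ (sym (value i)) (nonpos+nonpos (φ≤0 zero i) (f≤0 i))) ,
    (λ i eq → let φ≈0 , f≈0 = nonpos+nonpos≈0 (φ≤0 zero i) (f≤0 i) (trans (sym (value i)) eq)
              in λ { zero _ → φ≈0 ; (suc j) → f⇒ i f≈0 j }) ,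
    λ i h → trans (value i) (trans (+-cong (h zero D) (f⇐ i (h ∘ suc))) (+-identityˡ 0#))
    where
    value = λ i → dot-⊕ˡ (φ zero) f (u i)

  module Transfer (P Q : Polytope) {n m} (v q : Vector Point n)
    (P≐v : ⟦ P ⟧ ≐ ConvexHull v) (Q≐q : ⟦ Q ⟧ ≐ ConvexHull q)
    {t : Fin m → Triangle n} (T : IsTriangulation t) {φ ψ : Fin m → V 4}
    (C : IsConfiguration (hom ∘ v) t φ) (D : IsConfiguration (hom ∘ q) t ψ) where

    private
      module P = Realization P v P≐v T C
      module Q = Realization Q q Q≐q T D

    -- `G` is the intersection of the facets of `Q` whose indices are those of the facets of `P`
    -- containing `F`. Its vertices lie on `F` by `closed`.
    transfer : ∀ F → ∃ λ G → (∀ i → F P.∋ i → G Q.∋ i) × (∀ i → G Q.∋ i → F P.∋ i)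
    transfer F =
      let f , f≤0 , f⇒ , f⇐ = meet Q.u ψ Q.nonpositive {D = λ j → F P.⊆△ t j} (λ j → F P.⊆△? t j)
          value = λ i → Q.toFace-value f f≤0 (Q.u i)
      in Q.toFace f f≤0 ,
         (λ i F∋i → trans (value i) (f⇐ i λ j F⊆j → Q.on-∈ j (F⊆j i F∋i))) ,
         λ i G∋i → P.closed F i λ j F⊆j → Q.zero⇒∈ j i (f⇒ i (trans (sym (value i)) G∋i) j F⊆j)

  combinatoriallyEquivalent : ∀ (P Q : Polytope) {n m} (v q : Vector Point n) →
    ⟦ P ⟧ ≐ ConvexHull v → ⟦ Q ⟧ ≐ ConvexHull q →
    {t : Fin m → Triangle n} → IsTriangulation t → {φ ψ : Fin m → V 4} →
    IsConfiguration (hom ∘ v) t φ → IsConfiguration (hom ∘ q) t ψ → CombinatoriallyEquivalent P Q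
  combinatoriallyEquivalent P Q v q P≐v Q≐q T C D = to , record
    { isOrderMonomorphism = record
      { isOrderHomomorphism = record
        { cong = λ { {F} {G} (F≤G , G≤F) → mono {F} {G} F≤G , mono {G} {F} G≤F }
        ; mono = λ {F} {G} → mono {F} {G} }
      ; injective = λ { {F} {G} (F≤G , G≤F) → cancel {F} {G} F≤G , cancel {G} {F} G≤F }
      ; cancel = λ {F} {G} → cancel {F} {G} }
    -- The preimage is the transfer in the opposite direction; it returns to `G` up to `_≈ᶠ_`, as
    -- both have the same vertices.
    ; surjective = λ G → let F , G⇒F , F⇒G = PQ⁻¹.transfer G in F , λ { {F′} (F′≤F , F≤F′) →
        Q.∋⇒≤ᶠ {to F′} {G} (λ i → F⇒G i ∘ P.≤ᶠ⇒∋ {F′} {F} F′≤F i ∘ from F′ i) ,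
        Q.∋⇒≤ᶠ {G} {to F′} (λ i → into F′ i ∘ P.≤ᶠ⇒∋ {F} {F′} F≤F′ i ∘ G⇒F i) }
    }
    where
    module P = Realization P v P≐v T C
    module Q = Realization Q q Q≐q T D
    module PQ = Transfer P Q v q P≐v Q≐q T C D
    module PQ⁻¹ = Transfer Q P q v Q≐q P≐v T D C
    to : Face P → Face Q
    to F = proj₁ (PQ.transfer F)
    into : ∀ F i → F P.∋ i → to F Q.∋ i
    into F = proj₁ (proj₂ (PQ.transfer F))
    from : ∀ F i → to F Q.∋ i → F P.∋ i
    from F = proj₂ (proj₂ (PQ.transfer F))
    mono : ∀ {F G} → F ≤ᶠ G → to F ≤ᶠ to G
    mono {F} {G} F≤G = Q.∋⇒≤ᶠ {to F} {to G} λ i → into G i ∘ P.≤ᶠ⇒∋ {F} {G} F≤G i ∘ from F i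
    cancel : ∀ {F G} → to F ≤ᶠ to G → F ≤ᶠ G
    cancel {F} {G} F≤G = P.∋⇒≤ᶠ {F} {G} λ i → from G i ∘ Q.≤ᶠ⇒∋ {to F} {to G} F≤G i ∘ into F i

-- Lorentz geometry

module Lorentz {c ℓ} (ℝ : RealNumbers c ℓ) where

  open Koebe ℝ
  open RealNumbers ℝ hiding (zero)
  open OrderedField ℝ
  open LinearAlgebra ℝ
  open Configurations ℝ
  open ≈-Reasoning

  -- Passage between vectors and functionals by the Lorentz metric, in either direction. The metric
  -- matrix is its own inverse, so `B` measures facet functionals as well as vertices.
  flip : V 4 → V 4
  flip u = (- u zero) ∷ tail u

  -- The Lorentz form.  A point outside the unit sphere is represented by a
  -- vector of norm κ, and the line through two points touches the sphere on
  -- the segment between them iff their vectors u, v satisfy B u v ≈ - κ.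
  B : V 4 → V 4 → Carrier
  B u v = dot (flip u) v

  -- Norm 2 is that of the vectors (1, ±1, ±1, ±1), which keeps the start of the induction integral.
  -- In `x` below `κ` is the factor 2 of Descartes' relation, whose value does not depend on the
  -- choice of the norm.
  κ : Carrier
  κ = ι (+ 2)

  0<κ : 0# < κ
  0<κ = suc×1>0 1

  dot-flip : ∀ u v → dot u (flip v) ≈ B u v
  dot-flip u v = +-congʳ (solve 2 (λ x y → x :* :- y := :- x :* y) refl (u zero) (v zero))

  B-comm : ∀ u v → B u v ≈ B v u
  B-comm u v = trans (dot-comm (flip u) v) (dot-flip v u)

  B-flip : ∀ u v → B (flip u) v ≈ dot u v
  B-flip u v = +-congʳ (*-congʳ (-‿involutive (u zero)))

  B-⊕ˡ : ∀ u v w → B (u ⊕ v) w ≈ B u w + B v w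
  B-⊕ˡ u v w = begin
    B (u ⊕ v) w          ≈⟨ dot-flip (u ⊕ v) w ⟨
    dot (u ⊕ v) (flip w) ≈⟨ dot-⊕ˡ u v (flip w) ⟩
    dot u (flip w) + dot v (flip w) ≈⟨ +-cong (dot-flip u w) (dot-flip v w) ⟩
    B u w + B v w        ∎

  B-⊙ˡ : ∀ a u w → B (a ⊙ u) w ≈ a * B u w
  B-⊙ˡ a u w = trans (sym (dot-flip (a ⊙ u) w)) (trans (dot-⊙ˡ a u (flip w)) (*-congˡ (dot-flip u w)))

  B-cong : ∀ {u u′ v v′} → u ≗ u′ → v ≗ v′ → B u v ≈ B u′ v′
  B-cong {u} {u′} {v} {v′} u≗ v≗ = dot-cong {u = flip u} {flip u′} {v} {v′} (λ { zero → -‿cong (u≗ zero) ; (suc k) → u≗ (suc k) }) v≗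

  -- Two circle packings at once, one circle per vertex and one per facet; a product of at most -2
  -- keeps the disks from overlapping, with equality for tangency. `vertex-height` permits
  -- dehomogenizing without a change of signs, and `facet-height` says that the origin is beneath
  -- every facet. The two conditions sustain each other under stacking.
  record Packing {n m} (t : Fin m → Triangle n) (u : Fin n → V 4) (φ : Fin m → V 4) : Set (c ⊔ ℓ) where
    field
      configuration    : IsConfiguration u t φ
      vertex-norm      : ∀ i → B (u i) (u i) ≈ κ
      vertex-separated : ∀ i k → i ≢ k → B (u i) (u k) ≤ - κ
      vertex-tangent   : ∀ j r s → r ≢ s → B (u (t j r)) (u (t j s)) ≈ - κ
      facet-norm       : ∀ j → B (φ j) (φ j) ≈ κ
      facet-separated  : ∀ j k → j ≢ k → B (φ j) (φ k) ≤ - κ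
      vertex-height    : ∀ i → 0# < u i zero
      facet-height     : ∀ j → φ j zero < 0#
      vertex-rational  : ∀ i k → Rational (u i k)
      facet-rational   : ∀ j k → Rational (φ j k)

  total-nonpos : ∀ {a b c} → a ≤ 0# → b ≤ 0# → c ≤ 0# → a + (b + c) ≤ 0#
  total-nonpos a≤0 b≤0 c≤0 = nonpos+nonpos a≤0 (nonpos+nonpos b≤0 c≤0)

  -- The sum over the edge opposite `s`, written as a difference so that `s` can stay a variable in
  -- the formulas for `ψ`.
  remaining-nonpos : ∀ (f : V 3) → (∀ r → f r ≤ 0#) → ∀ s →
                     f zero + (f (suc zero) + f (suc (suc zero))) - f s ≤ 0#
  remaining-nonpos f f≤0 zero = ≤-respˡ (solve 3 (λ a b c → b :+ c := a :+ (b :+ c) :- a) refl _ _ _)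
    (nonpos+nonpos (f≤0 (suc zero)) (f≤0 (suc (suc zero))))
  remaining-nonpos f f≤0 (suc zero) = ≤-respˡ (solve 3 (λ a b c → a :+ c := a :+ (b :+ c) :- b) refl _ _ _)
    (nonpos+nonpos (f≤0 zero) (f≤0 (suc (suc zero))))
  remaining-nonpos f f≤0 (suc (suc zero)) = ≤-respˡ (solve 3 (λ a b c → a :+ b := a :+ (b :+ c) :- c) refl _ _ _)
    (nonpos+nonpos (f≤0 zero) (f≤0 (suc zero)))

  -κ≤0 : - κ ≤ 0#
  -κ≤0 = inj₁ (pos⇒neg 0<κ)

  module Stack-Packing {n m} {t : Fin (suc m) → Triangle n} {u : Fin n → V 4} {φ : Fin (suc m) → V 4}
    (T : IsTriangulation t) (K : Packing t u φ) (j : Fin (suc m)) where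

    open IsTriangulation T
    open Packing K
    open IsConfiguration configuration

    v : Fin 3 → V 4
    v s = u (t j s)

    w : V 4
    w = v zero ⊕ (v (suc zero) ⊕ v (suc (suc zero)))

    -- The two solutions d, d′ of the Apollonian problem for the circles of the
    -- vertices v satisfy d + d′ = 2 w (Descartes), and 2 flip (φ j) = w - d.
    x : V 4
    x = w ⊕ κ ⊙ flip (φ j)

    ψ : Fin 3 → V 4
    ψ s = φ j ⊕ flip (w -⟨ 1# ⟩ v s)

    B-w : ∀ y → B w y ≈ B (v zero) y + (B (v (suc zero)) y + B (v (suc (suc zero))) y)
    B-w y = trans (B-⊕ˡ (v zero) (v (suc zero) ⊕ v (suc (suc zero))) y) (+-congˡ (B-⊕ˡ (v (suc zero)) (v (suc (suc zero))) y))

    w-dot : ∀ f → dot f w ≈ dot f (v zero) + (dot f (v (suc zero)) + dot f (v (suc (suc zero))))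
    w-dot f = begin
      dot f w                ≈⟨ dot-comm f w ⟩
      dot w f                ≈⟨ dot-⊕ˡ (v zero) (v (suc zero) ⊕ v (suc (suc zero))) f ⟩
      dot (v zero) f + dot (v (suc zero) ⊕ v (suc (suc zero))) f
                             ≈⟨ +-congˡ (dot-⊕ˡ (v (suc zero)) (v (suc (suc zero))) f) ⟩
      dot (v zero) f + (dot (v (suc zero)) f + dot (v (suc (suc zero))) f)
                             ≈⟨ +-cong (dot-comm (v zero) f) (+-cong (dot-comm (v (suc zero)) f) (dot-comm (v (suc (suc zero))) f)) ⟩
      dot f (v zero) + (dot f (v (suc zero)) + dot f (v (suc (suc zero)))) ∎

    B-x : ∀ y → B x y ≈ B w y + κ * dot (φ j) y
    B-x y = trans (B-⊕ˡ w (κ ⊙ flip (φ j)) y) (+-congˡ (trans (B-⊙ˡ κ (flip (φ j)) y) (*-congˡ (B-flip (φ j) y))))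

    x-dot : ∀ f → dot f x ≈ dot f w + κ * B f (φ j)
    x-dot f = begin
      dot f x                                   ≈⟨ dot-comm f x ⟩
      dot x f                                   ≈⟨ dot-⊕ˡ w (κ ⊙ flip (φ j)) f ⟩
      dot w f + dot (κ ⊙ flip (φ j)) f          ≈⟨ +-cong (dot-comm w f) (dot-⊙ˡ κ (flip (φ j)) f) ⟩
      dot f w + κ * B (φ j) f                   ≈⟨ +-congˡ (*-congˡ (B-comm (φ j) f)) ⟩
      dot f w + κ * B f (φ j)                   ∎

    B-e : ∀ s y → B (w -⟨ 1# ⟩ v s) y ≈ B w y - B (v s) y
    B-e s y = trans (B-⊕ˡ w ((- 1#) ⊙ v s) y) (+-congˡ (trans (B-⊙ˡ (- 1#) (v s) y)
      (solve 1 (λ b → :- con (+ 1) :* b := :- b) refl (B (v s) y))))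

    ψ-dot : ∀ s y → dot (ψ s) y ≈ dot (φ j) y + (B w y - B (v s) y)
    ψ-dot s y = trans (dot-⊕ˡ (φ j) (flip (w -⟨ 1# ⟩ v s)) y) (+-congˡ (B-e s y))

    B-ψ : ∀ s f → B (ψ s) f ≈ B (φ j) f + (dot f w - dot f (v s))
    B-ψ s f = begin
      B (ψ s) f                                          ≈⟨ B-⊕ˡ (φ j) (flip (w -⟨ 1# ⟩ v s)) f ⟩
      B (φ j) f + B (flip (w -⟨ 1# ⟩ v s)) f             ≈⟨ +-congˡ (B-flip (w -⟨ 1# ⟩ v s) f) ⟩
      B (φ j) f + dot (w -⟨ 1# ⟩ v s) f                  ≈⟨ +-congˡ (dot-⟨⟩ w 1# (v s) f) ⟩
      B (φ j) f + (dot w f - 1# * dot (v s) f)           ≈⟨ +-congˡ (+-cong (dot-comm w f) (-‿cong (trans (*-identityˡ _) (dot-comm (v s) f)))) ⟩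
      B (φ j) f + (dot f w - dot f (v s))                ∎

    φ-w : dot (φ j) w ≈ 0#
    φ-w = trans (w-dot (φ j)) (trans (+-cong (on j zero) (+-cong (on j (suc zero)) (on j (suc (suc zero)))))
            (solve 0 (con (+ 0) :+ (con (+ 0) :+ con (+ 0)) := con (+ 0)) refl))

    B-wv : ∀ r → B w (v r) ≈ - κ
    B-wv zero = trans (B-w (v zero))
      (trans (+-cong (vertex-norm _) (+-cong (vertex-tangent j (suc zero) zero λ ()) (vertex-tangent j (suc (suc zero)) zero λ ())))
        (solve 0 (con (+ 2) :+ (:- con (+ 2) :+ :- con (+ 2)) := :- con (+ 2)) refl))
    B-wv (suc zero) = trans (B-w (v (suc zero)))
      (trans (+-cong (vertex-tangent j zero (suc zero) λ ()) (+-cong (vertex-norm _) (vertex-tangent j (suc (suc zero)) (suc zero) λ ())))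
        (solve 0 (:- con (+ 2) :+ (con (+ 2) :+ :- con (+ 2)) := :- con (+ 2)) refl))
    B-wv (suc (suc zero)) = trans (B-w (v (suc (suc zero))))
      (trans (+-cong (vertex-tangent j zero (suc (suc zero)) λ ()) (+-cong (vertex-tangent j (suc zero) (suc (suc zero)) λ ()) (vertex-norm _)))
        (solve 0 (:- con (+ 2) :+ (:- con (+ 2) :+ con (+ 2)) := :- con (+ 2)) refl))

    B-ww : B w w ≈ ι -[1+ 5 ]
    B-ww = trans (B-w w) (trans (+-cong (wv zero) (+-cong (wv (suc zero)) (wv (suc (suc zero)))))
             (solve 0 (:- con (+ 2) :+ (:- con (+ 2) :+ :- con (+ 2)) := con -[1+ 5 ]) refl))
      where
      wv : ∀ r → B (v r) w ≈ - κ
      wv r = trans (B-comm (v r) w) (B-wv r)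

    ψ-v : ∀ s r → dot (ψ s) (v r) ≈ - κ - B (v s) (v r)
    ψ-v s r = begin
      dot (ψ s) (v r)                                       ≈⟨ ψ-dot s (v r) ⟩
      dot (φ j) (v r) + (B w (v r) - B (v s) (v r))         ≈⟨ +-cong (on j r) (+-congʳ (B-wv r)) ⟩
      0# + (- κ - B (v s) (v r))                            ≈⟨ +-identityˡ _ ⟩
      - κ - B (v s) (v r)                                   ∎

    ψ-vₛ : ∀ s → dot (ψ s) (v s) ≈ ι -[1+ 3 ]
    ψ-vₛ s = trans (ψ-v s s) (trans (+-congˡ (-‿cong (vertex-norm (t j s))))
               (solve 0 (:- con (+ 2) :- con (+ 2) := con -[1+ 3 ]) refl))

    base : ∀ s r → r ≢ s → dot (ψ s) (v r) ≈ 0#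
    base s r r≢s = trans (ψ-v s r) (trans (+-congˡ (-‿cong (vertex-tangent j s r (r≢s ∘ ≡.sym))))
                     (solve 0 (:- con (+ 2) :- (:- con (+ 2)) := con (+ 0)) refl))

    -- Away from the triangle `φ j` is negative and the two edge terms are nonpositive by
    -- separation; at the opposite corner the value is -4.
    rest : ∀ s i → (∀ r → r ≢ s → t j r ≢ i) → dot (ψ s) (u i) < 0#
    rest s i i∉ = case off-edge (t j) s i i∉ of λ where
      (inj₁ i∉t) → <-respˡ (sym (trans (ψ-dot s (u i)) (+-congˡ (+-congʳ (B-w (u i))))))
        (neg+nonpos (off j i i∉t) (remaining-nonpos (λ r → B (v r) (u i))
          (λ r → ≤-trans (vertex-separated (t j r) i λ eq → i∉t (r , eq)) -κ≤0) s))
      (inj₂ ≡.refl) → <-respˡ (sym (ψ-vₛ s)) (pos⇒neg (suc×1>0 3))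

    B-ψφ : ∀ s → B (ψ s) (φ j) ≈ κ
    B-ψφ s = trans (B-ψ s (φ j)) (trans (+-cong (facet-norm j) (+-cong φ-w (-‿cong (on j s))))
               (solve 0 (con (+ 2) :+ (con (+ 0) :- con (+ 0)) := con (+ 2)) refl))

    ψ-w : ∀ s → dot (ψ s) w ≈ ι -[1+ 3 ]
    ψ-w s = begin
      dot (ψ s) w                                 ≈⟨ ψ-dot s w ⟩
      dot (φ j) w + (B w w - B (v s) w)           ≈⟨ +-cong φ-w (+-cong B-ww (-‿cong (trans (B-comm (v s) w) (B-wv s)))) ⟩
      0# + (ι -[1+ 5 ] - - κ)                     ≈⟨ solve 0 (con (+ 0) :+ (con -[1+ 5 ] :- :- con (+ 2)) := con -[1+ 3 ]) refl ⟩
      ι -[1+ 3 ]                                  ∎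

    apex : ∀ s → dot (ψ s) x ≈ 0#
    apex s = trans (x-dot (ψ s)) (trans (+-cong (ψ-w s) (*-congˡ (B-ψφ s)))
               (solve 0 (con -[1+ 3 ] :+ con (+ 2) :* con (+ 2) := con (+ 0)) refl))

    φ-x : dot (φ j) x ≈ ι (+ 4)
    φ-x = trans (x-dot (φ j)) (trans (+-cong φ-w (*-congˡ (facet-norm j)))
            (solve 0 (con (+ 0) :+ con (+ 2) :* con (+ 2) := con (+ 4)) refl))

    beyond : 0# < dot (φ j) x
    beyond = <-respʳ (sym φ-x) (suc×1>0 3)

    -- `φ l` is nonpositive at the three corners, and the normal term contributes twice a product of
    -- at most -2. Separation of the facets thus forbids the new vertex to see a second one.
    beneath : ∀ k → dot (φ (punchIn j k)) x < 0#
    beneath k = <-respˡ (trans (+-comm _ _) (sym (trans (x-dot (φ l)) (+-congʳ (w-dot (φ l))))))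
      (neg+nonpos (pos*neg 0<κ (≤-<-trans (facet-separated l j (Finₚ.punchInᵢ≢i j k)) (pos⇒neg 0<κ)))
        (total-nonpos (nonpositive l _) (nonpositive l _) (nonpositive l _)))
      where l = punchIn j k

    x-norm : B x x ≈ κ
    x-norm = begin
      B x x                                       ≈⟨ B-x x ⟩
      B w x + κ * dot (φ j) x                     ≈⟨ +-cong (trans (B-comm w x) (B-x w)) (*-congˡ φ-x) ⟩
      B w w + κ * dot (φ j) w + κ * ι (+ 4)       ≈⟨ +-congʳ (+-cong B-ww (*-congˡ φ-w)) ⟩
      ι -[1+ 5 ] + κ * 0# + κ * ι (+ 4)           ≈⟨ solve 0 (con -[1+ 5 ] :+ con (+ 2) :* con (+ 0) :+ con (+ 2) :* con (+ 4) := con (+ 2)) refl ⟩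
      κ                                           ∎

    x-tangent : ∀ r → B x (v r) ≈ - κ
    x-tangent r = trans (B-x (v r)) (trans (+-cong (B-wv r) (*-congˡ (on j r)))
                    (solve 0 (:- con (+ 2) :+ con (+ 2) :* con (+ 0) := :- con (+ 2)) refl))

    -- Off the triangle one corner already contributes at most -2, and all other terms are
    -- nonpositive.
    x-separated : ∀ i → B x (u i) ≤ - κ
    x-separated i with i ∈△? t j
    ... | yes (r , ≡.refl) = inj₂ (x-tangent r)
    ... | no  i∉t = ≤-respˡ (sym (trans (B-x (u i)) (+-congʳ (B-w (u i)))))
      (≤-respˡ (sym (+-assoc _ _ _)) (≤-respʳ (+-identityʳ (- κ)) (+-mono-≤ (sep zero)
        (nonpos+nonpos (nonpos+nonpos (≤-trans (sep (suc zero)) -κ≤0) (≤-trans (sep (suc (suc zero))) -κ≤0))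
          (nonneg*nonpos (inj₁ 0<κ) (nonpositive j i))))))
      where
      sep : ∀ r → B (v r) (u i) ≤ - κ
      sep r = vertex-separated (t j r) i λ eq → i∉t (r , eq)

    -- The new facets have the Gram matrix of the corners of the old one, so their norms and
    -- tangencies are inherited from the vertices.
    B-ψψ : ∀ s r → B (ψ s) (ψ r) ≈ B (v s) (v r)
    B-ψψ s r = begin
      B (ψ s) (ψ r)                                        ≈⟨ B-ψ s (ψ r) ⟩
      B (φ j) (ψ r) + (dot (ψ r) w - dot (ψ r) (v s))      ≈⟨ +-cong (trans (B-comm (φ j) (ψ r)) (B-ψφ r)) (+-cong (ψ-w r) (-‿cong (ψ-v r s))) ⟩
      κ + (ι -[1+ 3 ] - (- κ - B (v r) (v s)))             ≈⟨ solve 1 (λ b → con (+ 2) :+ (con -[1+ 3 ] :- (:- con (+ 2) :- b)) := b) refl _ ⟩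
      B (v r) (v s)                                        ≈⟨ B-comm (v r) (v s) ⟩
      B (v s) (v r)                                        ∎

    ψ-separated : ∀ s k → B (ψ s) (φ (punchIn j k)) ≤ - κ
    ψ-separated s k = ≤-respˡ (sym (trans (B-ψ s (φ l)) (+-congˡ (+-congʳ (w-dot (φ l))))))
      (≤-respʳ (+-identityʳ (- κ)) (+-mono-≤ (facet-separated j l (Finₚ.punchInᵢ≢i j k ∘ ≡.sym))
        (remaining-nonpos (λ r → dot (φ l) (v r)) (λ r → nonpositive l (t j r)) s)))
      where l = punchIn j k

    ψ-height : ∀ s → ψ s zero < 0#
    ψ-height s = <-respˡ (+-congˡ (solve 4 (λ a b c d → (:- a :+ (:- b :+ :- c)) :- (:- d) := :- (a :+ (b :+ c) :+ :- con (+ 1) :* d)) refl _ _ _ (v s zero)))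
      (neg+nonpos (facet-height j) (remaining-nonpos (λ r → - v r zero) (λ r → inj₁ (pos⇒neg (vertex-height (t j r)))) s))

    x-height : 0# < x zero
    x-height = pos+nonneg (pos+nonneg (h zero) (inj₁ (pos+nonneg (h (suc zero)) (inj₁ (h (suc (suc zero)))))))
      (inj₁ (*-pos 0<κ (neg⇒pos (facet-height j))))
      where
      h : ∀ r → 0# < v r zero
      h r = vertex-height (t j r)

    w-rational : ∀ k → Rational (w k)
    w-rational k = rational-+ (q zero) (rational-+ (q (suc zero)) (q (suc (suc zero))))
      where
      q : ∀ r → Rational (v r k)
      q r = vertex-rational (t j r) k

    flip-rational : ∀ {y : V 4} → (∀ k → Rational (y k)) → ∀ k → Rational (flip y k)
    flip-rational y∈ℚ zero    = rational-neg (y∈ℚ zero)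
    flip-rational y∈ℚ (suc k) = y∈ℚ (suc k)

    packing : Packing (stack△ t j) (x ∷ u) (ψ ++ removeAt φ j)
    packing = record
      { configuration    = Stacking.isConfiguration {u = x ∷ u} T configuration j beyond beneath ψ apex base rest
      ; vertex-norm      = λ { zero → x-norm ; (suc i) → vertex-norm i }
      ; vertex-separated = λ { zero zero 0≢0 → contradiction ≡.refl 0≢0
                             ; zero (suc k) _ → x-separated k
                             ; (suc i) zero _ → ≤-respˡ (B-comm x (u i)) (x-separated i)
                             ; (suc i) (suc k) i≢k → vertex-separated i k (i≢k ∘ ≡.cong suc) }
      ; vertex-tangent   = Allₚ.++⁺ (λ τ → ∀ r s → r ≢ s → B ((x ∷ u) (τ r)) ((x ∷ u) (τ s)) ≈ - κ)
          {xs = Stack.new t j} {ys = Stack.old t j} new-tangent (λ k → vertex-tangent (punchIn j k))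
      ; facet-norm       = Allₚ.++⁺ (λ f → B f f ≈ κ) {xs = ψ} {ys = removeAt φ j}
          (λ s → trans (B-ψψ s s) (vertex-norm (t j s))) (λ k → facet-norm (punchIn j k))
      ; facet-separated  = ++-pairwise ψ (removeAt φ j) (λ f g → B f g ≤ - κ)
          (λ s r s≢r → inj₂ (trans (B-ψψ s r) (vertex-tangent j s r s≢r)))
          ψ-separated
          (λ k s → ≤-respˡ (B-comm (ψ s) (removeAt φ j k)) (ψ-separated s k))
          (λ k l k≢l → facet-separated (punchIn j k) (punchIn j l) (k≢l ∘ Finₚ.punchIn-injective j k l))
      ; vertex-height    = λ { zero → x-height ; (suc i) → vertex-height i }
      ; facet-height     = Allₚ.++⁺ (λ f → f zero < 0#) {xs = ψ} {ys = removeAt φ j} ψ-height (λ k → facet-height (punchIn j k))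
      ; vertex-rational  = λ { zero k → rational-+ (w-rational k) (rational-* (rational-ι (+ 2)) (flip-rational (facet-rational j) k))
                             ; (suc i) → vertex-rational i }
      ; facet-rational   = Allₚ.++⁺ (λ f → ∀ k → Rational (f k)) {xs = ψ} {ys = removeAt φ j}
          (λ s k → rational-+ (facet-rational j k) (flip-rational {w -⟨ 1# ⟩ v s}
            (λ k → rational-+ (w-rational k) (rational-* (rational-neg (rational-ι (+ 1))) (vertex-rational (t j s) k))) k))
          (λ k → facet-rational (punchIn j k))
      }
      where
      new-tangent : ∀ s r q → r ≢ q → B ((x ∷ u) (cone△ (t j) s r)) ((x ∷ u) (cone△ (t j) s q)) ≈ - κ
      new-tangent s r q r≢q with r Finₚ.≟ s | q Finₚ.≟ s
      ... | yes ≡.refl | yes ≡.refl = contradiction ≡.refl r≢q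
      ... | yes ≡.refl | no q≢s
        rewrite cone△-apex (t j) s | cone△-base (t j) s q≢s = x-tangent q
      ... | no r≢s | yes ≡.refl
        rewrite cone△-apex (t j) s | cone△-base (t j) s r≢s = trans (B-comm (v r) x) (x-tangent r)
      ... | no r≢s | no q≢s
        rewrite cone△-base (t j) s r≢s | cone△-base (t j) s q≢s = vertex-tangent j r q r≢q

  -- The regular tetrahedron

  hadamard : Fin 4 → Fin 4 → ℤ
  hadamard zero                _                = + 1
  hadamard _                   zero             = + 1
  hadamard (suc i)             (suc k)          with i Finₚ.≟ k
  ... | yes _ = + 1
  ... | no  _ = -[1+ 0 ]

  dotℤ : ∀ {n} → Vector ℤ n → Vector ℤ n → ℤ
  dotℤ a b = Vector.foldr ℤ._+_ (+ 0) (λ k → a k ℤ.* b k)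

  ι-dot : ∀ {n} (a b : Vector ℤ n) → dot (ι ∘ a) (ι ∘ b) ≈ ι (dotℤ a b)
  ι-dot {zero}  a b = refl
  ι-dot {suc n} a b = sym (trans (ι-homo-+ (a zero ℤ.* b zero) (dotℤ (tail a) (tail b)))
    (+-cong (ι-homo-* (a zero) (b zero)) (sym (ι-dot (tail a) (tail b)))))

  flipℤ negℤ : Vector ℤ 4 → Vector ℤ 4
  flipℤ a = (ℤ.- a zero) ∷ tail a
  negℤ a k = ℤ.- a k

  ι-B : ∀ a b → B (ι ∘ a) (ι ∘ b) ≈ ι (dotℤ (flipℤ a) b)
  ι-B a b = trans (+-congʳ (*-congʳ (sym (ι-homo-neg (a zero))))) (ι-dot (flipℤ a) b)

  -- The rows of a Hadamard matrix: the vertices of the regular tetrahedron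
  -- inscribed in the cube [-1, 1]³, whose edges touch the unit sphere.
  regular-vertex : Fin 4 → V 4
  regular-vertex i = ι ∘ hadamard i

  -- The rows are orthogonal of square length 4, so minus a row vanishes at the other three vertices
  -- and is -4 at its own.
  regular-facet : Fin 4 → V 4
  regular-facet j = ι ∘ negℤ (hadamard j)

  ≢-punchIn : ∀ {n p} (P : Fin (suc n) → Fin (suc n) → Set p) → (∀ i k → P i (punchIn i k)) → ∀ i k → i ≢ k → P i k
  ≢-punchIn P h i k i≢k = ≡.subst (P i) (Finₚ.punchIn-punchOut i≢k) (h i (punchOut i≢k))

  regular-packing : Packing tetrahedron regular-vertex regular-facet
  regular-packing = record
    { configuration    = Simplex.isConfiguration independent on off
    -- The quantifier is inside the decision procedure, so the check runs on closed integer terms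
    -- and `from-yes` evaluates it.
    ; vertex-norm      = λ i → trans (ι-B (hadamard i) (hadamard i)) (by (from-yes (Finₚ.all? λ i → dotℤ (flipℤ (hadamard i)) (hadamard i) ℤₚ.≟ + 2) i))
    ; vertex-separated = λ i k i≢k → inj₂ (tangent i k i≢k)
    ; vertex-tangent   = λ j r s r≢s → tangent (punchIn j r) (punchIn j s) (r≢s ∘ Finₚ.punchIn-injective j r s)
    ; facet-norm       = λ i → trans (ι-B (negℤ (hadamard i)) (negℤ (hadamard i)))
        (by (from-yes (Finₚ.all? λ i → dotℤ (flipℤ (negℤ (hadamard i))) (negℤ (hadamard i)) ℤₚ.≟ + 2) i))
    ; facet-separated  = λ i k i≢k → inj₂ (≢-punchIn (λ i k → B (regular-facet i) (regular-facet k) ≈ - κ) (λ i k →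
        trans (ι-B (negℤ (hadamard i)) (negℤ (hadamard (punchIn i k)))) (by (from-yes (Finₚ.all? λ i → Finₚ.all? λ k →
          dotℤ (flipℤ (negℤ (hadamard i))) (negℤ (hadamard (punchIn i k))) ℤₚ.≟ -[1+ 1 ]) i k))) i k i≢k)
    ; vertex-height    = λ { zero → 0<1 ; (suc i) → 0<1 }
    ; facet-height     = λ { zero → pos⇒neg 0<1 ; (suc i) → pos⇒neg 0<1 }
    ; vertex-rational  = λ i k → rational-ι (hadamard i k)
    ; facet-rational   = λ j k → rational-ι (negℤ (hadamard j) k)
    }
    where
    by : ∀ {a b} → a ≡ b → ι a ≈ ι b
    by a≡b = reflexive (≡.cong ι a≡b)
    tangent : ∀ i k → i ≢ k → B (regular-vertex i) (regular-vertex k) ≈ - κ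
    tangent = ≢-punchIn (λ i k → B (regular-vertex i) (regular-vertex k) ≈ - κ) λ i k →
      trans (ι-B (hadamard i) (hadamard (punchIn i k))) (by (from-yes (Finₚ.all? λ i → Finₚ.all? λ k →
          dotℤ (flipℤ (hadamard i)) (hadamard (punchIn i k)) ℤₚ.≟ -[1+ 1 ]) i k))
    on : ∀ j s → dot (regular-facet j) (regular-vertex (punchIn j s)) ≈ 0#
    on j s = trans (ι-dot (negℤ (hadamard j)) (hadamard (punchIn j s))) (by (from-yes (Finₚ.all? λ j → Finₚ.all? λ s →
          dotℤ (negℤ (hadamard j)) (hadamard (punchIn j s)) ℤₚ.≟ + 0) j s))
    off : ∀ j → dot (regular-facet j) (regular-vertex j) < 0#
    off j = <-respˡ (sym (trans (ι-dot (negℤ (hadamard j)) (hadamard j)) (by (from-yes (Finₚ.all? λ j →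
          dotℤ (negℤ (hadamard j)) (hadamard j) ℤₚ.≟ -[1+ 3 ]) j)))) (pos⇒neg (suc×1>0 3))
    independent : Independent regular-vertex
    independent = Faces.dual-independent ℝ {w = regular-vertex} {g = regular-facet} (λ j → <⇒≉ (off j))
      (λ j i i≢j → ≢-punchIn (λ j i → dot (regular-facet j) (regular-vertex i) ≈ 0#) on j i (i≢j ∘ ≡.sym))

-- Koebe realizations

module Main {c ℓ} (ℝ : RealNumbers c ℓ) where

  open Koebe ℝ
  open RealNumbers ℝ hiding (zero)
  open OrderedField ℝ
  open LinearAlgebra ℝ
  open Configurations ℝ
  open Faces ℝ
  open Lorentz ℝ
  open ≈-Reasoning

  -- Division by positive heights changes no sign, so the facet functionals of the packing serve the
  -- actual points unchanged.
  rescale : ∀ {n m} {u w : Fin n → V 4} {t : Fin m → Triangle n} {φ : Fin m → V 4} (h : Fin n → Carrier) →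
            (∀ i → 0# < h i) → (∀ i → u i ≗ h i ⊙ w i) → IsConfiguration u t φ → IsConfiguration w t φ
  rescale {u = u} {w} {t} {φ} h 0<h u≗hw C = record
    { on   = λ j s → x*y≈0⇒y≈0 (h≉0 (t j s)) (trans (sym (value (φ j) (t j s))) (on j s))
    ; off  = λ j i i∉ → unscale (0<h i) (<-respˡ (value (φ j) i) (off j i i∉))
    ; span = λ j g g≈0 → span j g λ s → trans (value g (t j s)) (trans (*-congˡ (g≈0 s)) (zeroʳ _))
    ; cone = λ g g≤0 → cone g λ i → ≤-respˡ (sym (value g i)) (nonneg*nonpos (inj₁ (0<h i)) (g≤0 i))
    }
    where
    open IsConfiguration C
    h≉0 : ∀ i → h i ≉ 0#
    h≉0 i eq = <⇒≉ (0<h i) (sym eq)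
    value : ∀ f i → dot f (u i) ≈ h i * dot f (w i)
    value f i = trans (dot-cong {u = f} (λ _ → refl) (u≗hw i)) (dot-⊙ʳ (h i) f (w i))
    unscale : ∀ {a x} → 0# < a → a * x < 0# → x < 0#
    unscale {a} {x} 0<a ax<0 = <-respˡ (trans (*-comm _ _) (trans (sym (*-assoc _ a x)) (trans (*-congʳ (*-inverseˡ a a≉0)) (*-identityˡ x))))
      (<-respˡ (*-comm _ _) (pos*neg (inverse-pos 0<a a≉0) ax<0))
      where
      a≉0 : a ≉ 0#
      a≉0 eq = <⇒≉ 0<a (sym eq)

  -- The given points with their functionals, and a packing with its own vertices and facets, tied
  -- together only by `triangles`. The successor provides a facet to remove when stacking.
  record Model {n} (v : Vector Point n) : Set (c ⊔ ℓ) where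
    field
      {size′}         : ℕ
      triangles       : Fin (suc size′) → Triangle n
      isTriangulation : IsTriangulation triangles
      functionals     : Fin (suc size′) → V 4
      configuration   : IsConfiguration (hom ∘ v) triangles functionals
      vertices        : Fin n → V 4
      facets          : Fin (suc size′) → V 4
      packing         : Packing triangles vertices facets

  module StackModel {n} (v : Vector Point n) (M : Model v) (F : Face (conv v)) (x : Point) (F-Beyond : Beyond F x) where

    open Model M
    open Realization (conv v) v (id , id) isTriangulation configuration

    private
      φ = functionals
      separated = beyond⇒sign F x F-Beyond
      j = proj₁ separated
      beyond = proj₁ (proj₂ separated)
      beneath = proj₂ (proj₂ separated)
      module K = Stack-Packing isTriangulation packing j
      y = hom x

    -- The combination of a facet functional and its neighbour across an edge
    -- supporting the triangle spanned by x and that edge.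
    ψ : Fin 3 → V 4
    ψ s = (- dot (opposite j s) y) ⊙ φ j ⊕ dot (φ j) y ⊙ opposite j s

    ψ-value : ∀ s z → dot (ψ s) z ≈ - dot (opposite j s) y * dot (φ j) z + dot (φ j) y * dot (opposite j s) z
    ψ-value s z = trans (dot-⊕ˡ ((- dot (opposite j s) y) ⊙ φ j) (dot (φ j) y ⊙ opposite j s) z)
      (+-cong (dot-⊙ˡ (- dot (opposite j s) y) (φ j) z) (dot-⊙ˡ (dot (φ j) y) (opposite j s) z))

    apex : ∀ s → dot (ψ s) y ≈ 0#
    apex s = trans (ψ-value s y) (solve 2 (λ a b → :- a :* b :+ b :* a := con (+ 0)) refl (dot (opposite j s) y) (dot (φ j) y))

    base : ∀ s r → r ≢ s → dot (ψ s) (u (triangles j r)) ≈ 0#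
    base s r r≢s = trans (ψ-value s (u (triangles j r))) (trans (+-cong (*-congˡ (on j r)) (*-congˡ (opposite-off j s r r≢s)))
      (solve 2 (λ a b → :- a :* con (+ 0) :+ b :* con (+ 0) := con (+ 0)) refl (dot (opposite j s) y) (dot (φ j) y)))

    -- Both coefficients of `ψ s` are positive, because `x` is beyond `φ j` and beneath its
    -- neighbour. Hence both terms are nonpositive at every vertex; off the triangle the first is
    -- strict, at the corner `s` the second.
    rest : ∀ s i → (∀ r → r ≢ s → triangles j r ≢ i) → dot (ψ s) (u i) < 0#
    rest s i i∉ = <-respˡ (sym (ψ-value s (u i))) sign
      where
      k : Fin _
      k = proj₁ (neighbour j s)
      0<a : 0# < - dot (opposite j s) y
      0<a = neg⇒pos (beneath k (neighbour-≢ j s ∘ ≡.sym))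
      tjs∉tk : triangles j s ∉△ triangles k
      tjs∉tk = proj₁ (proj₂ (neighbour j s))
      sign : - dot (opposite j s) y * dot (φ j) (u i) + dot (φ j) y * dot (opposite j s) (u i) < 0#
      sign = case off-edge (triangles j) s i i∉ of λ where
        (inj₁ i∉tj)   → neg+nonpos (pos*neg 0<a (off j i i∉tj)) (nonneg*nonpos (inj₁ beyond) (nonpositive k i))
        (inj₂ ≡.refl) → <-respˡ (+-comm _ _)
          (neg+nonpos (pos*neg beyond (off k (triangles j s) tjs∉tk)) (nonneg*nonpos (inj₁ 0<a) (nonpositive j (triangles j s))))

    model : Model (x ∷ v)
    model = record
      { triangles       = stack△ triangles j
      ; isTriangulation = stack△-isTriangulation isTriangulation j
      ; functionals     = ψ ++ removeAt φ j
      ; configuration   = Stacking.isConfiguration {u = hom ∘ (x ∷ v)} isTriangulation configuration j beyond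
                            (λ k → beneath (punchIn j k) (Finₚ.punchInᵢ≢i j k)) ψ apex base rest
      ; vertices        = K.x ∷ vertices
      ; facets          = K.ψ ++ removeAt facets j
      ; packing         = K.packing
      }

  model : ∀ {n} {v : Vector Point n} → StackedVertices v → Model v
  model (simplex v v-independent) = record
    { triangles       = tetrahedron
    ; isTriangulation = tetrahedron-isTriangulation
    ; functionals     = λ j → proj₁ (dual j)
    ; configuration   = Simplex.isConfiguration {u = hom ∘ v} independent (λ j → proj₂ (proj₂ (dual j))) (λ j → proj₁ (proj₂ (dual j)))
    ; vertices        = regular-vertex
    ; facets          = regular-facet
    ; packing         = regular-packing
    }
    where
    independent : Independent (hom ∘ v)
    independent = affinelyIndependent⁻ {p = v} v-independent
    dual : ∀ j → ∃ λ g → dot g (hom (v j)) < 0# × ∀ i → dot g (hom (v (punchIn j i))) ≈ 0#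
    dual = dual-functional {w = hom ∘ v} independent
  model (stack {v = v} S F _ x F-Beyond) = StackModel.model v (model S) F x F-Beyond

  convexHull-segment : ∀ {n} (v : Vector Point n) i k {a b} → 0# ≤ a → 0# ≤ b → a + b ≈ 1# →
                       ∀ {x} → (∀ l → x l ≈ a * v i l + b * v k l) → ConvexHull v x
  convexHull-segment v i k {a} {b} 0≤a 0≤b a+b≈1 x≋ =
    t , (λ l → nonneg+nonneg (nonneg*nonneg 0≤a (δ-nonneg i l)) (nonneg*nonneg 0≤b (δ-nonneg k l))) ,
    trans (sum-cong-≋ λ l → sym (*-identityʳ (t l))) (trans (t-dot (const 1#)) (trans (+-cong (*-identityʳ a) (*-identityʳ b)) a+b≈1)) ,
    λ l → trans (x≋ l) (sym (t-dot (λ i → v i l)))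
    where
    t : V _
    t = a ⊙ δ i ⊕ b ⊙ δ k
    t-dot : ∀ y → dot t y ≈ a * y i + b * y k
    t-dot y = trans (dot-⊕ˡ (a ⊙ δ i) (b ⊙ δ k) y) (+-cong (trans (dot-⊙ˡ a (δ i) y) (*-congˡ (dot-δ i y)))
                (trans (dot-⊙ˡ b (δ k) y) (*-congˡ (dot-δ k y))))

  ∙≈1 : ∀ x y → B (hom x) (hom y) ≈ 0# → x ∙ y ≈ 1#
  ∙≈1 x y eq = x-y≈0⇒x≈y (trans (trans (+-comm _ _) (+-congʳ (sym (*-identityʳ (- 1#))))) eq)

  module KoebePolytope {n m} {t : Fin (suc m) → Triangle n} (T : IsTriangulation t)
    {u : Fin n → V 4} {φ : Fin (suc m) → V 4} (K : Packing t u φ) where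

    open Packing K

    h : Fin n → Carrier
    h i = u i zero

    h≉0 : ∀ i → h i ≉ 0#
    h≉0 i eq = <⇒≉ (vertex-height i) (sym eq)

    dehomogenize : ∀ (z : V 4) → z zero ≉ 0# → Point
    dehomogenize z z₀≉0 k = quotient (z (suc k)) z₀≉0

    hom-dehomogenize : ∀ z (z₀≉0 : z zero ≉ 0#) → z ≗ z zero ⊙ hom (dehomogenize z z₀≉0)
    hom-dehomogenize z z₀≉0 zero    = sym (*-identityʳ _)
    hom-dehomogenize z z₀≉0 (suc k) = trans (sym (quotient-* _ z₀≉0)) (*-comm _ _)

    q : Vector Point n
    q i = dehomogenize (u i) (h≉0 i)

    u≗hq : ∀ i → u i ≗ h i ⊙ hom (q i)
    u≗hq i = hom-dehomogenize (u i) (h≉0 i)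

    q-configuration : IsConfiguration (hom ∘ q) t φ
    q-configuration = rescale h vertex-height u≗hq configuration

    q-rational : ∀ i k → Rational (q i k)
    q-rational i k = rational-* (vertex-rational i (suc k)) (rational-invert (vertex-rational i zero) (*-inverseʳ _ (h≉0 i)))

    open Realization (conv q) q (id , id) T q-configuration using (_∋_; vanishes-on; vertex-index; module Edge)

    module Tangency {a b : Fin n} (B-ab : B (u a) (u b) ≈ - κ) where

      -- The point of tangency in homogeneous coordinates. Norms 2 and product -2 make `z`
      -- orthogonal to both ends and therefore lightlike: it projects to a point of the sphere whose
      -- tangent plane contains the edge, and positive heights place it on the segment.
      z : V 4
      z = u a ⊕ u b

      0<z₀ : 0# < z zero
      0<z₀ = pos+nonneg (vertex-height a) (inj₁ (vertex-height b))

      z₀≉0 : z zero ≉ 0#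
      z₀≉0 eq = <⇒≉ 0<z₀ (sym eq)

      p : Point
      p = dehomogenize z z₀≉0

      B-za : B z (u a) ≈ 0#
      B-za = trans (B-⊕ˡ (u a) (u b) (u a)) (trans (+-cong (vertex-norm a) (trans (B-comm (u b) (u a)) B-ab)) (-‿inverseʳ κ))

      B-zb : B z (u b) ≈ 0#
      B-zb = trans (B-⊕ˡ (u a) (u b) (u b)) (trans (+-cong B-ab (vertex-norm b)) (-‿inverseˡ κ))

      B-zz : B z z ≈ 0#
      B-zz = begin
        B z z                     ≈⟨ B-⊕ˡ (u a) (u b) z ⟩
        B (u a) z + B (u b) z     ≈⟨ +-cong (trans (B-comm (u a) z) B-za) (trans (B-comm (u b) z) B-zb) ⟩
        0# + 0#                   ≈⟨ +-identityˡ 0# ⟩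
        0#                        ∎

      scaled : ∀ {y h′ y′} → h′ ≉ 0# → y ≗ h′ ⊙ hom y′ → B z y ≈ 0# → B (hom p) (hom y′) ≈ 0#
      scaled {y} {h′} {y′} h′≉0 y≗ eq = x*y≈0⇒y≈0 h′≉0 (x*y≈0⇒y≈0 z₀≉0 (begin
        z zero * (h′ * B (hom p) (hom y′))       ≈⟨ *-congˡ (dot-⊙ʳ h′ (flip (hom p)) (hom y′)) ⟨
        z zero * B (hom p) (h′ ⊙ hom y′)         ≈⟨ B-⊙ˡ (z zero) (hom p) (h′ ⊙ hom y′) ⟨
        B (z zero ⊙ hom p) (h′ ⊙ hom y′)         ≈⟨ B-cong (hom-dehomogenize z z₀≉0) y≗ ⟨
        B z y                                    ≈⟨ eq ⟩
        0#                                       ∎))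

      p-sphere : UnitSphere p
      p-sphere = ∙≈1 p p (scaled {z} z₀≉0 (hom-dehomogenize z z₀≉0) B-zz)

      B-pa : B (hom p) (hom (q a)) ≈ 0#
      B-pa = scaled {u a} (h≉0 a) (u≗hq a) B-za

      B-pb : B (hom p) (hom (q b)) ≈ 0#
      B-pb = scaled {u b} (h≉0 b) (u≗hq b) B-zb

      p∈hull : ConvexHull q p
      p∈hull = convexHull-segment q a b {h a * i} {h b * i} (weight a) (weight b)
        (trans (sym (distribʳ i (h a) (h b))) (*-inverseʳ _ z₀≉0)) {p} λ k → begin
          (u a (suc k) + u b (suc k)) * i                      ≈⟨ *-congʳ (+-cong (u≗hq a (suc k)) (u≗hq b (suc k))) ⟩
          (h a * q a k + h b * q b k) * i
            ≈⟨ solve 5 (λ x y x′ y′ i → (x :* y :+ x′ :* y′) :* i := x :* i :* y :+ x′ :* i :* y′) refl (h a) (q a k) (h b) (q b k) i ⟩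
          h a * i * q a k + h b * i * q b k                    ∎
        where
        i = z zero ⁻¹⟨ z₀≉0 ⟩
        weight : ∀ l → 0# ≤ h l * i
        weight l = inj₁ (*-pos (vertex-height l) (inverse-pos 0<z₀ z₀≉0))

      vanishes-at-p : ∀ f → dot f (hom (q a)) ≈ 0# → dot f (hom (q b)) ≈ 0# → dot f (hom p) ≈ 0#
      vanishes-at-p f fa fb = x*y≈0⇒y≈0 z₀≉0 (begin
        z zero * dot f (hom p)                                   ≈⟨ dot-⊙ʳ (z zero) f (hom p) ⟨
        dot f (z zero ⊙ hom p)                                   ≈⟨ dot-cong {u = f} (λ _ → refl) (hom-dehomogenize z z₀≉0) ⟨
        dot f z                                                  ≈⟨ dot-comm f z ⟩
        dot z f                                                  ≈⟨ dot-⊕ˡ (u a) (u b) f ⟩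
        dot (u a) f + dot (u b) f                                ≈⟨ +-cong (at a fa) (at b fb) ⟩
        0# + 0#                                                  ≈⟨ +-identityˡ 0# ⟩
        0#                                                       ∎)
        where
        at : ∀ i → dot f (hom (q i)) ≈ 0# → dot (u i) f ≈ 0#
        at i eq = begin
          dot (u i) f                  ≈⟨ dot-comm (u i) f ⟩
          dot f (u i)                  ≈⟨ dot-cong {u = f} (λ _ → refl) (u≗hq i) ⟩
          dot f (h i ⊙ hom (q i))      ≈⟨ dot-⊙ʳ (h i) f (hom (q i)) ⟩
          h i * dot f (hom (q i))      ≈⟨ *-congˡ eq ⟩
          h i * 0#                     ≈⟨ zeroʳ (h i) ⟩
          0#                           ∎

    tangent : ∀ (E : Face (conv q)) → IsEdge E → TangentToUnitSphere (points E)
    -- `zero` is the arbitrary facet from which the search for one containing `E` starts.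
    tangent E E-isEdge = from-vertices (Edge.edge-vertices {E} E-isEdge zero)
      where
      from-vertices : (∃₂ λ j s → (∀ r → E ∋ t j (punchIn s r)) × (∀ i → E ∋ i → ∃ λ r → t j (punchIn s r) ≡ i)) →
                      TangentToUnitSphere (points E)
      from-vertices (j , s , E∋ , only) =
        p , (p∈hull , x-y≈0⇒x≈y (trans (sym (functional-value E p)) (vanishes-at-p (functional E) (E∋ zero) (E∋ (suc zero))))) ,
        p-sphere , λ x x∈E → ∙≈1 p x (vanishes-on {E} (flip (hom p)) on-E {x} x∈E)
        where
        open Tangency {t j (punchIn s zero)} {t j (punchIn s (suc zero))}
          (vertex-tangent j (punchIn s zero) (punchIn s (suc zero)) (λ eq → case Finₚ.punchIn-injective s zero (suc zero) eq of λ ()))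
        on-E : ∀ i → E ∋ i → dot (flip (hom p)) (hom (q i)) ≈ 0#
        on-E i E∋i with only i E∋i
        ... | zero     , ≡.refl = B-pa
        ... | suc zero , ≡.refl = B-pb

    field-rational : ∀ {x} → x ∈ ℚ[ VertexCoordinate (conv q) ] → Rational x
    field-rational (rational x∈ℚ) = x∈ℚ
    field-rational (generator (x , k , x-vertex , y≈xₖ)) =
      let i , qi≋x = vertex-index x-vertex
      in rational-resp (trans (qi≋x k) (sym y≈xₖ)) (q-rational i k)
    field-rational (plus x y)       = rational-+ (field-rational x) (field-rational y)
    field-rational (negate x)       = rational-neg (field-rational x)
    field-rational (times x y)      = rational-* (field-rational x) (field-rational y)
    field-rational (invert x xy≈1)  = rational-invert (field-rational x) xy≈1
    field-rational (resp x x≈y)     = rational-resp x≈y (field-rational x)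

    degree-one : HasDegreeOverℚ ℚ[ VertexCoordinate (conv q) ] 1
    degree-one = const 1# , record
      { member      = λ _ → rational (rational-ι (+ 1))
      ; spanning    = λ x x∈ → const x , (λ _ → field-rational x∈) , sym (trans (+-identityʳ _) (*-identityʳ x))
      ; independent = λ { a _ eq zero → trans (sym (trans (+-identityʳ _) (*-identityʳ (a zero)))) eq }
      }

  -- With an empty basis the spanning condition would equate 1 with the empty sum.
  degree-positive : ∀ L d → HasDegreeOverℚ ℚ[ L ] d → 1 ℕ.≤ d
  degree-positive L zero    (b , basis) =
    contradiction (proj₂ (proj₂ (IsBasisOverℚ.spanning basis 1# (rational (rational-ι (+ 1)))))) 1≉0
  degree-positive L (suc d) _           = ℕ.s≤s ℕ.z≤n

theorem23 : ∀ {c ℓ} (ℝ : RealNumbers c ℓ) → let open Koebe ℝ in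
    ∀ (P : Polytope) → IsStacked P → KoebeDegreeEquals P 1
theorem23 ℝ P (n , v , S , P≐v) = (Q , Main.KoebePolytope.degree-one ℝ isTriangulation packing) ,
                                  λ Q d → Main.degree-positive ℝ _ d
  where
  open Koebe ℝ
  open Main.Model (Main.model ℝ S)
  module K = Main.KoebePolytope ℝ isTriangulation packing
  Q : KoebeRealization P
  Q = record
    { polytope   = conv K.q
    ; equivalent = Faces.combinatoriallyEquivalent ℝ P (conv K.q) v K.q P≐v (id , id) isTriangulation configuration K.q-configuration
    ; tangent    = K.tangent
    }
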